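{- For every $\varepsilon>0$, $k,\ell\in\mathbb N$ and $A\in\mathcal R(k,\ell)$, the proportion of Latin squares $L$ of order $n$ satisfying $|t(A,L)-\frac1{(k\ell)!}|\le\varepsilon$, among all Latin squares of order $n$, tends to $1$ as $n\to\infty$.
   Context: A Latin square of order $n$ is an $n\times n$ matrix with entries in $[n]$, each row and column containing each value once. $\mathcal R(k,\ell)$ is the set of $k\times\ell$ matrices with entries in $[k\ell]$, each value appearing exactly once. Real matrices $A\equiv B$ if each entry of $A$ has the same rank among the distinct values of $A$ as the corresponding entry of $B$ among those of $B$. For a Latin square $L$ of order $n\ge k,\ell$, $t(A,L)=\binom nk^{ -1}\binom n\ell^{ -1}\sum\mathbb 1[L|_{(\mathbf x,\mathbf y)}\equiv A]$, summing over strictly increasing $\mathbf x\in[n]^k,\mathbf y\in[n]^\ell$, where $L|_{(\mathbf x,\mathbf y)}$ is the submatrix with rows $\mathbf x$ and columns $\mathbf y$. -}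

module Defs where

open import Level using (0ℓ)
open import Data.Nat as ℕ using (ℕ; zero; suc; _*_)
open import Data.Nat.Combinatorics using (_C_)
open import Data.Nat.Base using (_!)
open import Data.Integer using (+_)
open import Data.Fin using (Fin; _<_; _<?_)
open import Data.Fin.Properties using (_≟_; all?; any?)
open import Data.Product using (_×_; _,_; proj₁; proj₂; ∃-syntax)
open import Data.List using (List; []; _∷_; length; filter; allFin; map; concatMap; cartesianProduct)
open import Data.Vec.Functional as VF using ()
open import Data.Rational as ℚ using (ℚ; 0ℚ; _/_; ∣_∣; _-_)
open import Data.Rational.Properties as ℚP using ()
open import Relation.Binary.PropositionalEquality using (_≡_)
open import Relation.Nullary using (Dec)
open import Relation.Nullary.Decidable using (_×-dec_; _→-dec_)
open import Relation.Unary using (Pred; Decidable)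

Matrix : Set → ℕ → ℕ → Set
Matrix A k ℓ = Fin k → Fin ℓ → A

count : ∀ {m} {P : Pred (Fin m) 0ℓ} → Decidable P → ℕ
count {m} P? = length (filter P? (allFin m))

allFuns : ∀ {A : Set} (k : ℕ) → List A → List (Fin k → A)
allFuns zero    xs = (λ ()) ∷ []
allFuns (suc k) xs = concatMap (λ a → map (λ f → a VF.∷ f) (allFuns k xs)) xs

allSquares : (n : ℕ) → List (Matrix (Fin n) n n)
allSquares n = allFuns n (allFuns n (allFin n))

IsLatin : (n : ℕ) → Matrix (Fin n) n n → Set
IsLatin n L = (∀ i v → count (λ j → L i j ≟ v) ≡ 1)
            × (∀ j v → count (λ i → L i j ≟ v) ≡ 1)

isLatin? : (n : ℕ) → (L : Matrix (Fin n) n n) → Dec (IsLatin n L)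
isLatin? n L = all? (λ i → all? (λ v → count (λ j → L i j ≟ v) ℕ.≟ 1))
         ×-dec all? (λ j → all? (λ v → count (λ i → L i j ≟ v) ℕ.≟ 1))

latinSquares : (n : ℕ) → List (Matrix (Fin n) n n)
latinSquares n = filter (isLatin? n) (allSquares n)

InR : (k ℓ : ℕ) → Matrix (Fin (k * ℓ)) k ℓ → Set
InR k ℓ A = ∀ v → length (filter (λ p → A (proj₁ p) (proj₂ p) ≟ v)
                                 (cartesianProduct (allFin k) (allFin ℓ))) ≡ 1

rank : ∀ {k ℓ m} → Matrix (Fin m) k ℓ → Fin m → ℕ
rank M x = count (λ v → (v <? x) ×-dec any? (λ i → any? (λ j → M i j ≟ v)))

OrdEquiv : ∀ {k ℓ m m'} → Matrix (Fin m) k ℓ → Matrix (Fin m') k ℓ → Set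
OrdEquiv A B = ∀ i j → rank A (A i j) ≡ rank B (B i j)

ordEquiv? : ∀ {k ℓ m m'} → (A : Matrix (Fin m) k ℓ) → (B : Matrix (Fin m') k ℓ) → Dec (OrdEquiv A B)
ordEquiv? A B = all? (λ i → all? (λ j → rank A (A i j) ℕ.≟ rank B (B i j)))

StrictInc : ∀ {n k} → (Fin k → Fin n) → Set
StrictInc x = ∀ i j → i < j → x i < x j

strictInc? : ∀ {n k} → (x : Fin k → Fin n) → Dec (StrictInc x)
strictInc? x = all? (λ i → all? (λ j → (i <? j) →-dec (x i <? x j)))

incSeqs : (n k : ℕ) → List (Fin k → Fin n)
incSeqs n k = filter strictInc? (allFuns k (allFin n))

submatrix : ∀ {A : Set} {n k ℓ} → Matrix A n n → (Fin k → Fin n) → (Fin ℓ → Fin n) → Matrix A k ℓ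
submatrix L x y i j = L (x i) (y j)

-- a / b as a rational (a / 0 := 0; only used with positive denominators below)
_÷_ : ℕ → ℕ → ℚ
a ÷ zero  = 0ℚ
a ÷ suc b = (+ a) / suc b

t : ∀ {k ℓ n} → Matrix (Fin (k * ℓ)) k ℓ → Matrix (Fin n) n n → ℚ
t {k} {ℓ} {n} A L =
  length (filter (λ p → ordEquiv? A (submatrix L (proj₁ p) (proj₂ p)))
                 (cartesianProduct (incSeqs n k) (incSeqs n ℓ)))
  ÷ ((n C k) * (n C ℓ))

proportion : ∀ {k ℓ} → ℚ → Matrix (Fin (k * ℓ)) k ℓ → ℕ → ℚ
proportion {k} {ℓ} ε A n =
  length (filter (λ L → ∣ t A L - (1 ÷ ((k * ℓ) !)) ∣ ℚP.≤? ε) (latinSquares n))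
  ÷ length (latinSquares n)

{-# OPTIONS --safe #-}
-- Relabelling the symbols permutes the Latin squares of order n, so swapping the values that a random
-- Latin square L takes at two cells preserves its distribution. Hence, given that the entries of L on a
-- set of cells are distinct, all m! relative orders of m = k ℓ of these cells are equally likely,
-- independently of the entries on the other cells. For two placements P, Q of the pattern, the variables
-- m! 1[L|P ≡ A] - 1 and m! 1[L|Q ≡ A] - 1 are therefore uncorrelated on the event that the entries read by
-- P and Q are all distinct; for every Latin square this fails for only O(1/n) of the pairs (P, Q), since
-- an entry and its row (or column) determine its column (or row). So the number of occurrences of A has
-- relative variance O(1/n), and Chebyshev's inequality concludes.
module Submission where

open import Defs

-- Invariance concerns two fixed symbols, whereas swapping the values at two cells exchanges symbols
-- that depend on the square; splitting the sum by the two values bridges this. The equal likelihood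
-- of the `m !` orders is obtained without enumerating permutations: one letter is taken out of the
-- ordered word, and since an increasing word accepts a new letter in exactly one place, averaging
-- over the places of insertion frees that letter. It joins the unordered letters, so the event that
-- all letters are distinct never changes. The pattern enters only through the order in which its
-- cells are read: by increasing entry of `A`, so that an occurrence becomes an increasing word.
-- Failure of distinctness is bounded by the number of equal pairs of letters, and each pair by
-- letting a single row or column index run through all of `Fin n`. This forces a passage from
-- increasing sequences to arbitrary functions, which costs the constant factors `2 ^ k * k !` and
-- `2 ^ ℓ * ℓ !` on returning to binomial coefficients. Denominators are cleared throughout, so that
-- the probabilistic part is an argument about integer sums.

-- Finite integer sums and indicators

module Sums where

  open import Level using (Level)
  open import Data.Bool.Base using (true; false; if_then_else_)
  open import Data.Nat.Base as ℕ using (ℕ; zero; suc)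
  open import Data.Integer hiding (suc)
  open import Data.Integer.Properties
  open import Data.Integer.Tactic.RingSolver using (solve-∀)
  open import Data.Fin.Base using (Fin; zero; suc)
  import Data.Fin.Properties as Fin
  open import Data.List.Base
    using (List; []; _∷_; _++_; map; concatMap; filter; length; cartesianProduct; allFin; tabulate)
  open import Data.List.Properties using (length-tabulate)
  open import Data.List.Membership.Propositional using (_∈_)
  open import Data.List.Relation.Unary.Any using (here; there)
  open import Data.Product.Base using (_×_; _,_)
  open import Function.Base using (_∘_)
  open import Relation.Nullary using (Dec; does; yes; no; ¬_; ¬?)
  open import Relation.Nullary.Decidable using (_×-dec_; dec-true; dec-false)
  open import Relation.Unary using (Pred; Decidable)
  open import Relation.Binary.PropositionalEquality

  private variable
    a b p q : Level
    A B : Set a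

  ∑ : List A → (A → ℤ) → ℤ
  ∑ []       f = 0ℤ
  ∑ (x ∷ xs) f = f x + ∑ xs f

  infix 5 ∑
  syntax ∑ xs (λ x → e) = ∑[ x ∈ xs ] e

  opaque
    -- Opaque so that unification can recover the decision procedure from χ P?.
    χ : {P : Set p} → Dec P → ℤ
    χ P? = if does P? then 1ℤ else 0ℤ

    χ-yes : {P : Set p} (P? : Dec P) → P → χ P? ≡ 1ℤ
    χ-yes P? x = cong (if_then 1ℤ else 0ℤ) (dec-true P? x)

    χ-no : {P : Set p} (P? : Dec P) → ¬ P → χ P? ≡ 0ℤ
    χ-no P? x = cong (if_then 1ℤ else 0ℤ) (dec-false P? x)

    χ-⇔ : {P : Set p} {Q : Set q} (P? : Dec P) (Q? : Dec Q) → (P → Q) → (Q → P) → χ P? ≡ χ Q?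
    χ-⇔ (yes x) Q? f g = sym (χ-yes Q? (f x))
    χ-⇔ (no ¬x) Q? f g = sym (χ-no Q? (¬x ∘ g))

    χ-× : {P : Set p} {Q : Set q} (P? : Dec P) (Q? : Dec Q) → χ (P? ×-dec Q?) ≡ χ P? * χ Q?
    χ-× (yes _) Q? = sym (*-identityˡ (χ Q?))
    χ-× (no _)  Q? = refl

    χ≥0 : {P : Set p} (P? : Dec P) → 0ℤ ≤ χ P?
    χ≥0 (yes _) = +≤+ ℕ.z≤n
    χ≥0 (no _)  = +≤+ ℕ.z≤n

    χ≤1 : {P : Set p} (P? : Dec P) → χ P? ≤ 1ℤ
    χ≤1 (yes _) = ≤-refl
    χ≤1 (no _)  = +≤+ ℕ.z≤n

    χ-mono : {P : Set p} {Q : Set q} (P? : Dec P) (Q? : Dec Q) → (P → Q) → χ P? ≤ χ Q?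
    χ-mono (yes x) Q? f = ≤-reflexive (sym (χ-yes Q? (f x)))
    χ-mono (no _)  Q? f = χ≥0 Q?

    χ-¬ : {P : Set p} (P? : Dec P) → χ P? + χ (¬? P?) ≡ 1ℤ
    χ-¬ (yes _) = refl
    χ-¬ (no _)  = refl

    -- Lets an equation that is known only under `P` be applied inside a term weighted by the
    -- indicator of `P`.
    χ-elim : {P : Set p} (P? : Dec P) {x y : ℤ} → (P → x ≡ y) → χ P? * x ≡ χ P? * y
    χ-elim (yes p) eq = cong (1ℤ *_) (eq p)
    χ-elim (no _)  eq = refl

  ∑-cong-∈ : (xs : List A) {f g : A → ℤ} → (∀ {x} → x ∈ xs → f x ≡ g x) → ∑ xs f ≡ ∑ xs g
  ∑-cong-∈ []       eq = refl
  ∑-cong-∈ (x ∷ xs) eq = cong₂ _+_ (eq (here refl)) (∑-cong-∈ xs (eq ∘ there))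

  ∑-cong : (xs : List A) {f g : A → ℤ} → (∀ x → f x ≡ g x) → ∑ xs f ≡ ∑ xs g
  ∑-cong xs eq = ∑-cong-∈ xs (λ {x} _ → eq x)

  ∑-mono-∈ : (xs : List A) {f g : A → ℤ} → (∀ {x} → x ∈ xs → f x ≤ g x) → ∑ xs f ≤ ∑ xs g
  ∑-mono-∈ []       le = ≤-refl
  ∑-mono-∈ (x ∷ xs) le = +-mono-≤ (le (here refl)) (∑-mono-∈ xs (le ∘ there))

  ∑-mono : (xs : List A) {f g : A → ℤ} → (∀ x → f x ≤ g x) → ∑ xs f ≤ ∑ xs g
  ∑-mono xs le = ∑-mono-∈ xs (λ {x} _ → le x)

  ∑-zero : (xs : List A) → (∑[ _ ∈ xs ] 0ℤ) ≡ 0ℤ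
  ∑-zero []       = refl
  ∑-zero (x ∷ xs) = trans (+-identityˡ _) (∑-zero xs)

  ∑-nonneg : (xs : List A) {f : A → ℤ} → (∀ x → 0ℤ ≤ f x) → 0ℤ ≤ ∑ xs f
  ∑-nonneg xs le = ≤-trans (≤-reflexive (sym (∑-zero xs))) (∑-mono xs le)

  ∑-+ : (xs : List A) (f g : A → ℤ) → (∑[ x ∈ xs ] (f x + g x)) ≡ ∑ xs f + ∑ xs g
  ∑-+ []       f g = refl
  ∑-+ (x ∷ xs) f g = trans (cong (λ s → (f x + g x) + s) (∑-+ xs f g)) (interchange (f x) (g x) _ _)
    where
    interchange : ∀ a b c d → a + b + (c + d) ≡ a + c + (b + d)
    interchange = solve-∀

  ∑-*ˡ : (xs : List A) (c : ℤ) (f : A → ℤ) → (∑[ x ∈ xs ] (c * f x)) ≡ c * ∑ xs f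
  ∑-*ˡ []       c f = sym (*-zeroʳ c)
  ∑-*ˡ (x ∷ xs) c f =
    trans (cong (λ s → c * f x + s) (∑-*ˡ xs c f)) (sym (*-distribˡ-+ c (f x) (∑ xs f)))

  ∑-*ʳ : (xs : List A) (f : A → ℤ) (c : ℤ) → (∑[ x ∈ xs ] (f x * c)) ≡ ∑ xs f * c
  ∑-*ʳ xs f c =
    trans (∑-cong xs (λ x → *-comm (f x) c)) (trans (∑-*ˡ xs c f) (*-comm c (∑ xs f)))

  ∑-const : (xs : List A) (c : ℤ) → (∑[ _ ∈ xs ] c) ≡ + length xs * c
  ∑-const []       c = refl
  ∑-const (x ∷ xs) c = trans (cong (λ s → c + s) (∑-const xs c)) (lemma (+ length xs) c)
    where
    lemma : ∀ l c → c + l * c ≡ (1ℤ + l) * c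
    lemma = solve-∀

  ∑-swap : (xs : List A) (ys : List B) (f : A → B → ℤ) →
           (∑[ x ∈ xs ] ∑[ y ∈ ys ] f x y) ≡ (∑[ y ∈ ys ] ∑[ x ∈ xs ] f x y)
  ∑-swap []       ys f = sym (∑-zero ys)
  ∑-swap (x ∷ xs) ys f =
    trans (cong (λ s → ∑ ys (f x) + s) (∑-swap xs ys f)) (sym (∑-+ ys (f x) _))

  ∑-++ : (xs ys : List A) (f : A → ℤ) → ∑ (xs ++ ys) f ≡ ∑ xs f + ∑ ys f
  ∑-++ []       ys f = sym (+-identityˡ _)
  ∑-++ (x ∷ xs) ys f = trans (cong (λ s → f x + s) (∑-++ xs ys f)) (sym (+-assoc (f x) _ _))

  ∑-map : (h : A → B) (xs : List A) (f : B → ℤ) → ∑ (map h xs) f ≡ ∑ xs (f ∘ h)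
  ∑-map h []       f = refl
  ∑-map h (x ∷ xs) f = cong (λ s → f (h x) + s) (∑-map h xs f)

  ∑-concatMap : (h : A → List B) (xs : List A) (f : B → ℤ) →
                ∑ (concatMap h xs) f ≡ (∑[ x ∈ xs ] ∑ (h x) f)
  ∑-concatMap h []       f = refl
  ∑-concatMap h (x ∷ xs) f =
    trans (∑-++ (h x) (concatMap h xs) f) (cong (λ s → ∑ (h x) f + s) (∑-concatMap h xs f))

  ∑-cartesianProduct : (xs : List A) (ys : List B) (f : A × B → ℤ) →
                       ∑ (cartesianProduct xs ys) f ≡ (∑[ x ∈ xs ] ∑[ y ∈ ys ] f (x , y))
  ∑-cartesianProduct []       ys f = refl
  ∑-cartesianProduct (x ∷ xs) ys f =
    trans (∑-++ (map (x ,_) ys) _ f) (cong₂ _+_ (∑-map (x ,_) ys f) (∑-cartesianProduct xs ys f))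

  opaque
    unfolding χ

    ∑-filter : {P : Pred A p} (P? : Decidable P) (xs : List A) (f : A → ℤ) →
               ∑ (filter P? xs) f ≡ (∑[ x ∈ xs ] (χ (P? x) * f x))
    ∑-filter P? []       f = refl
    ∑-filter P? (x ∷ xs) f with does (P? x)
    ... | true  = cong₂ _+_ (sym (*-identityˡ (f x))) (∑-filter P? xs f)
    ... | false = trans (∑-filter P? xs f) (sym (+-identityˡ _))

    length-filter≡∑ : {P : Pred A p} (P? : Decidable P) (xs : List A) →
                      + length (filter P? xs) ≡ ∑ xs (χ ∘ P?)
    length-filter≡∑ P? []       = refl
    length-filter≡∑ P? (x ∷ xs) with does (P? x)
    ... | true  = cong (λ s → 1ℤ + s) (length-filter≡∑ P? xs)
    ... | false = trans (length-filter≡∑ P? xs) (sym (+-identityˡ _))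

  length≡∑ : (xs : List A) → + length xs ≡ (∑[ _ ∈ xs ] 1ℤ)
  length≡∑ xs = sym (trans (∑-const xs 1ℤ) (*-identityʳ _))

  ∑-tabulate : ∀ {n} (h : Fin n → A) (f : A → ℤ) → ∑ (tabulate h) f ≡ ∑ (allFin n) (f ∘ h)
  ∑-tabulate {n = zero}  h f = refl
  ∑-tabulate {n = suc n} h f =
    cong (λ s → f (h zero) + s) (trans (∑-tabulate (h ∘ suc) f) (sym (∑-tabulate suc (f ∘ h))))

  ∑-allFin-suc : ∀ {n} (f : Fin (suc n) → ℤ) →
                 ∑ (allFin (suc n)) f ≡ f zero + ∑ (allFin n) (f ∘ suc)
  ∑-allFin-suc f = cong (λ s → f zero + s) (∑-tabulate suc f)

  ∑-allFin-const : ∀ n c → (∑[ _ ∈ allFin n ] c) ≡ + n * c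
  ∑-allFin-const n c =
    trans (∑-const (allFin n) c) (cong (λ l → + l * c) (length-tabulate {n = n} (λ i → i)))

  opaque
    unfolding χ

    ∑-δ : ∀ {n} (v : Fin n) (f : Fin n → ℤ) → (∑[ i ∈ allFin n ] (χ (v Fin.≟ i) * f i)) ≡ f v
    ∑-δ {suc n} zero f = begin
      ∑ (allFin (suc n)) (λ i → χ (zero Fin.≟ i) * f i)
        ≡⟨ ∑-allFin-suc (λ i → χ (zero Fin.≟ i) * f i) ⟩
      1ℤ * f zero + (∑[ i ∈ allFin n ] (0ℤ * f (suc i)))
        ≡⟨ cong₂ _+_ (*-identityˡ (f zero)) (∑-zero (allFin n)) ⟩
      f zero + 0ℤ
        ≡⟨ +-identityʳ _ ⟩
      f zero ∎
      where open ≡-Reasoning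
    ∑-δ {suc n} (suc v) f = begin
      ∑ (allFin (suc n)) (λ i → χ (suc v Fin.≟ i) * f i)
        ≡⟨ ∑-allFin-suc (λ i → χ (suc v Fin.≟ i) * f i) ⟩
      0ℤ + (∑[ i ∈ allFin n ] (χ (suc v Fin.≟ suc i) * f (suc i)))
        ≡⟨ +-identityˡ _ ⟩
      (∑[ i ∈ allFin n ] (χ (suc v Fin.≟ suc i) * f (suc i)))
        ≡⟨ ∑-cong (allFin n) (λ i → cong (_* f (suc i))
             (χ-⇔ (suc v Fin.≟ suc i) (v Fin.≟ i) Fin.suc-injective (cong suc))) ⟩
      (∑[ i ∈ allFin n ] (χ (v Fin.≟ i) * f (suc i)))
        ≡⟨ ∑-δ v (f ∘ suc) ⟩
      f (suc v) ∎
      where open ≡-Reasoning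

  -- Double counting: the pairs with `f i ≡ j` are the pairs with `g j ≡ i`, and each row and each
  -- column of this relation contains exactly one of them.
  ∑-inverse : ∀ {n} (f g : Fin n → Fin n) → (∀ i → f (g i) ≡ i) → (∀ i → g (f i) ≡ i) →
              ∀ h → ∑ (allFin n) (h ∘ f) ≡ ∑ (allFin n) h
  ∑-inverse {n} f g fg gf h = begin
    ∑ (allFin n) (h ∘ f)
      ≡⟨ ∑-cong (allFin n) (λ i → sym (∑-δ (f i) h)) ⟩
    (∑[ i ∈ allFin n ] ∑[ j ∈ allFin n ] (χ (f i Fin.≟ j) * h j))
      ≡⟨ ∑-swap (allFin n) (allFin n) _ ⟩
    (∑[ j ∈ allFin n ] ∑[ i ∈ allFin n ] (χ (f i Fin.≟ j) * h j))
      ≡⟨ ∑-cong (allFin n) (λ j → ∑-cong (allFin n) (λ i → cong (_* h j)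
           (χ-⇔ (f i Fin.≟ j) (g j Fin.≟ i)
              (λ e → trans (cong g (sym e)) (gf i)) (λ e → trans (cong f (sym e)) (fg j))))) ⟩
    (∑[ j ∈ allFin n ] ∑[ i ∈ allFin n ] (χ (g j Fin.≟ i) * h j))
      ≡⟨ ∑-cong (allFin n) (λ j → ∑-δ (g j) (λ _ → h j)) ⟩
    ∑ (allFin n) h ∎
    where open ≡-Reasoning

-- Words with distinct or increasing letters, and insertion of a letter

module Words where

  open import Data.Nat.Base as ℕ using (ℕ; suc)
  open import Data.Integer using (ℤ; 1ℤ; +_; _+_; _*_)
  open import Data.Integer.Properties
    using (*-distribˡ-+; *-distribʳ-+; *-identityˡ; *-assoc)
  open import Data.Integer.Tactic.RingSolver using (solve-∀)
  open import Data.Fin.Base using (Fin)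
  open import Data.Fin.Properties as Fin using (_≟_; _<?_; <-cmp)
  open import Data.Fin.Permutation.Components using (transpose)
  open import Data.List.Base using (List; []; _∷_; _++_; map; length)
  open import Data.List.Properties using (map-id-local; map-++; ++-assoc)
  open import Data.List.Relation.Unary.All as All using (All; []; _∷_; all?)
  import Data.List.Relation.Unary.All.Properties as Allₚ
  open import Data.List.Relation.Unary.AllPairs using ([]; _∷_; allPairs?)
  open import Data.List.Relation.Unary.Unique.Propositional using (Unique)
  open import Data.List.Relation.Unary.Unique.Propositional.Properties using (map⁺; map⁻)
  open import Data.List.Relation.Unary.Unique.DecPropositional using (unique?)
  open import Data.List.Relation.Binary.Permutation.Propositional
    using (_↭_; ↭-refl; ↭-sym; ↭-trans; prep; swap; ↭⇒↭ₛ)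
  import Data.List.Relation.Binary.Permutation.Propositional.Properties as ↭
  import Data.List.Relation.Binary.Permutation.Setoid.Properties as ↭Setoid
  open import Data.Product.Base using (_×_; _,_)
  open import Relation.Nullary using (Dec; yes; no; ¬?; contradiction)
  open import Relation.Nullary.Decidable using (_×-dec_)
  open import Relation.Binary.Definitions using (tri<; tri≈; tri>)
  open import Relation.Binary.PropositionalEquality

  open Sums

  private variable
    n : ℕ
    A B : Set

  transpose-left : (i j : Fin n) → transpose i j i ≡ j
  transpose-left i j with i ≟ i
  ... | yes _  = refl
  ... | no i≢i = contradiction refl i≢i

  transpose-right : (i j : Fin n) → transpose i j j ≡ i
  transpose-right i j with j ≟ i
  ... | yes refl = refl
  ... | no _ with j ≟ j
  ...   | yes _  = refl
  ...   | no j≢j = contradiction refl j≢j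

  transpose-other : {i j x : Fin n} → i ≢ x → j ≢ x → transpose i j x ≡ x
  transpose-other {i = i} {j} {x} i≢x j≢x with x ≟ i
  ... | yes x≡i = contradiction (sym x≡i) i≢x
  ... | no _ with x ≟ j
  ...   | yes x≡j = contradiction (sym x≡j) j≢x
  ...   | no _    = refl

  transpose-involutive : (i j x : Fin n) → transpose i j (transpose i j x) ≡ x
  transpose-involutive i j x with i ≟ x | j ≟ x
  ... | yes refl | _        = trans (cong (transpose i j) (transpose-left i j)) (transpose-right i j)
  ... | no _     | yes refl = trans (cong (transpose i j) (transpose-right i j)) (transpose-left i j)
  ... | no i≢x   | no j≢x   = trans (cong (transpose i j) (transpose-other i≢x j≢x)) (transpose-other i≢x j≢x)

  transpose-adjoint : (i j x y : Fin n) → transpose i j x ≡ y → x ≡ transpose i j y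
  transpose-adjoint i j x y eq = trans (sym (transpose-involutive i j x)) (cong (transpose i j) eq)

  Unique-resp-↭ : {u v : List (Fin n)} → u ↭ v → Unique u → Unique v
  Unique-resp-↭ p = ↭Setoid.Unique-resp-↭ (setoid _) (↭⇒↭ₛ p)

  fresh? : (a : Fin n) (u : List (Fin n)) → Dec (All (a ≢_) u)
  fresh? a = all? (λ b → ¬? (a ≟ b))

  U inc : List (Fin n) → ℤ
  U u   = χ (unique? _≟_ u)
  inc u = χ (allPairs? _<?_ u)

  U-↭ : {u v : List (Fin n)} → u ↭ v → U u ≡ U v
  U-↭ p = χ-⇔ _ _ (Unique-resp-↭ p) (Unique-resp-↭ (↭-sym p))

  U-transpose : (i j : Fin n) (u : List (Fin n)) → U (map (transpose i j) u) ≡ U u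
  U-transpose i j u = χ-⇔ _ _ (map⁻ {f = transpose i j} {xs = u})
    (map⁺ (λ {x} {y} e → trans (transpose-adjoint i j x _ e) (transpose-involutive i j y)))

  -- When all letters are distinct, `a` and `b` each mark a single position. Exchanging the two
  -- symbols of the alphabet therefore exchanges two adjacent positions and moves nothing else, in
  -- particular nothing in `v`.
  map-transpose-swap : (pre : List (Fin n)) (a b : Fin n) (ys v : List (Fin n)) →
    Unique ((pre ++ a ∷ b ∷ ys) ++ v) →
    map (transpose b a) (pre ++ a ∷ b ∷ ys) ≡ pre ++ b ∷ a ∷ ys × map (transpose b a) v ≡ v
  map-transpose-swap pre a b ys v uniq
    -- Bringing `a` and `b` to the front shows that both differ from all letters of `pre`, `ys` and
    -- `v`.
    with (_ ∷ a≢) ∷ b≢ ∷ _ ← Unique-resp-↭ (↭-trans (↭.shift a pre _) (prep a (↭.shift b pre (ys ++ v))))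
           (subst Unique (++-assoc pre (a ∷ b ∷ ys) v) uniq)
    with a≢pre , a≢ys++v ← Allₚ.++⁻ pre a≢
    with b≢pre , b≢ys++v ← Allₚ.++⁻ pre b≢
    with a≢ys , a≢v ← Allₚ.++⁻ ys a≢ys++v
    with b≢ys , b≢v ← Allₚ.++⁻ ys b≢ys++v =
    trans (map-++ (transpose b a) pre (a ∷ b ∷ ys))
      (cong₂ _++_ (fixed a≢pre b≢pre)
        (cong₂ _∷_ (transpose-right b a) (cong₂ _∷_ (transpose-left b a) (fixed a≢ys b≢ys))))
    , fixed a≢v b≢v
    where
    fixed : ∀ {w} → All (a ≢_) w → All (b ≢_) w → map (transpose b a) w ≡ w
    fixed a≢w b≢w = map-id-local (All.zipWith (λ (a≢x , b≢x) → transpose-other b≢x a≢x) (a≢w , b≢w))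

  -- The sum of `f` over the `1 + length zs` insertions of a letter into `zs`, one for each gap. The
  -- letters already passed are absorbed into the functional.
  insΣ : (List A → ℤ) → A → List A → ℤ
  insΣ f z []       = f (z ∷ [])
  insΣ f z (y ∷ ys) = f (z ∷ y ∷ ys) + insΣ (λ r → f (y ∷ r)) z ys

  insΣ-cong : (z : A) (zs : List A) {f g : List A → ℤ} →
              (∀ {r} → r ↭ z ∷ zs → f r ≡ g r) → insΣ f z zs ≡ insΣ g z zs
  insΣ-cong z []       eq = eq ↭-refl
  insΣ-cong z (y ∷ ys) eq =
    cong₂ _+_ (eq ↭-refl) (insΣ-cong z ys (λ p → eq (↭-trans (prep y p) (swap y z ↭-refl))))

  insΣ-*ˡ : (c : ℤ) (f : List A → ℤ) (z : A) (zs : List A) →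
            insΣ (λ r → c * f r) z zs ≡ c * insΣ f z zs
  insΣ-*ˡ c f z []       = refl
  insΣ-*ˡ c f z (y ∷ ys) =
    trans (cong (λ s → c * f (z ∷ y ∷ ys) + s) (insΣ-*ˡ c (λ r → f (y ∷ r)) z ys))
      (sym (*-distribˡ-+ c (f (z ∷ y ∷ ys)) (insΣ (λ r → f (y ∷ r)) z ys)))

  insΣ-const : (c : ℤ) (z : A) (zs : List A) → insΣ (λ _ → c) z zs ≡ + suc (length zs) * c
  insΣ-const c z []       = sym (*-identityˡ c)
  insΣ-const c z (y ∷ ys) = trans (cong (λ s → c + s) (insΣ-const c z ys)) (lemma (+ length ys) c)
    where
    lemma : ∀ l c → c + (1ℤ + l) * c ≡ (1ℤ + (1ℤ + l)) * c
    lemma = solve-∀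

  insΣ-map : (h : A → B) (f : List B → ℤ) (z : A) (zs : List A) →
             insΣ (λ r → f (map h r)) z zs ≡ insΣ f (h z) (map h zs)
  insΣ-map h f z []       = refl
  insΣ-map h f z (y ∷ ys) =
    cong (λ s → f (h z ∷ h y ∷ map h ys) + s) (insΣ-map h (λ r → f (h y ∷ r)) z ys)

  insΣ-∑ : (xs : List B) (f : B → List A → ℤ) (z : A) (zs : List A) →
           insΣ (λ r → ∑[ x ∈ xs ] f x r) z zs ≡ (∑[ x ∈ xs ] insΣ (f x) z zs)
  insΣ-∑ xs f z []       = refl
  insΣ-∑ xs f z (y ∷ ys) =
    trans (cong (λ s → (∑[ x ∈ xs ] f x (z ∷ y ∷ ys)) + s) (insΣ-∑ xs (λ x r → f x (y ∷ r)) z ys))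
      (sym (∑-+ xs (λ x → f x (z ∷ y ∷ ys)) (λ x → insΣ (λ r → f x (y ∷ r)) z ys)))

  inc-∷ : (y : Fin n) (r : List (Fin n)) → inc (y ∷ r) ≡ χ (all? (y <?_) r) * inc r
  inc-∷ y r = trans (χ-⇔ _ (all? (y <?_) r ×-dec allPairs? _<?_ r)
                       (λ { (p ∷ q) → p , q }) (λ { (p , q) → p ∷ q }))
                    (χ-× (all? (y <?_) r) (allPairs? _<?_ r))

  inc-∷∷ : (z y : Fin n) (ys : List (Fin n)) → inc (z ∷ y ∷ ys) ≡ χ (z <? y) * inc (y ∷ ys)
  inc-∷∷ z y ys = trans
    (χ-⇔ _ (z <? y ×-dec allPairs? _<?_ (y ∷ ys))
      (λ { ((z<y ∷ _) ∷ q) → z<y , q })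
      (λ { (z<y , y<ys ∷ q) → (z<y ∷ All.map (Fin.<-trans z<y) y<ys) ∷ y<ys ∷ q }))
    (χ-× (z <? y) (allPairs? _<?_ (y ∷ ys)))

  -- A new letter fits into an increasing word in exactly one gap, and no insertion makes a word
  -- increasing that was not so before.
  insΣ-inc : (z : Fin n) (zs : List (Fin n)) → All (z ≢_) zs → insΣ inc z zs ≡ inc zs
  insΣ-inc z []       _            = χ-⇔ _ _ (λ _ → []) (λ _ → [] ∷ [])
  insΣ-inc z (y ∷ ys) (z≢y ∷ z≢ys) = begin
    inc (z ∷ y ∷ ys) + insΣ (λ r → inc (y ∷ r)) z ys
      ≡⟨ cong₂ _+_ (inc-∷∷ z y ys) (insΣ-cong z ys split) ⟩
    χ (z <? y) * inc (y ∷ ys) + insΣ (λ r → χ (y <? z) * χ (all? (y <?_) ys) * inc r) z ys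
      ≡⟨ cong (λ s → χ (z <? y) * inc (y ∷ ys) + s) (insΣ-*ˡ (χ (y <? z) * χ (all? (y <?_) ys)) inc z ys) ⟩
    χ (z <? y) * inc (y ∷ ys) + χ (y <? z) * χ (all? (y <?_) ys) * insΣ inc z ys
      ≡⟨ cong (λ s → χ (z <? y) * inc (y ∷ ys) + χ (y <? z) * χ (all? (y <?_) ys) * s)
           (insΣ-inc z ys z≢ys) ⟩
    χ (z <? y) * inc (y ∷ ys) + χ (y <? z) * χ (all? (y <?_) ys) * inc ys
      ≡⟨ cong (λ s → χ (z <? y) * inc (y ∷ ys) + s)
           (trans (*-assoc (χ (y <? z)) _ (inc ys)) (cong (χ (y <? z) *_) (sym (inc-∷ y ys)))) ⟩
    χ (z <? y) * inc (y ∷ ys) + χ (y <? z) * inc (y ∷ ys)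
      ≡⟨ sym (*-distribʳ-+ (inc (y ∷ ys)) (χ (z <? y)) (χ (y <? z))) ⟩
    (χ (z <? y) + χ (y <? z)) * inc (y ∷ ys)
      ≡⟨ cong (_* inc (y ∷ ys)) total ⟩
    1ℤ * inc (y ∷ ys)
      ≡⟨ *-identityˡ _ ⟩
    inc (y ∷ ys) ∎
    where
    open ≡-Reasoning
    -- That `y` lies below everything after it depends only on the multiset of those letters, so
    -- this factor is common to all positions of `z` behind `y` and leaves the sum.
    split : ∀ {r} → r ↭ z ∷ ys → inc (y ∷ r) ≡ χ (y <? z) * χ (all? (y <?_) ys) * inc r
    split {r} p = trans (inc-∷ y r) (cong (_* inc r) (trans
      (χ-⇔ _ (y <? z ×-dec all? (y <?_) ys)
        (λ q → case-∷ (↭.All-resp-↭ p q))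
        (λ (y<z , q) → ↭.All-resp-↭ (↭-sym p) (y<z ∷ q)))
      (χ-× (y <? z) (all? (y <?_) ys))))
      where
      case-∷ : ∀ {P : Fin _ → Set} {x xs} → All P (x ∷ xs) → P x × All P xs
      case-∷ (q ∷ qs) = q , qs
    total : χ (z <? y) + χ (y <? z) ≡ 1ℤ
    total with <-cmp z y
    ... | tri< z<y _ y≮z = cong₂ _+_ (χ-yes (z <? y) z<y) (χ-no (y <? z) y≮z)
    ... | tri≈ _ z≡y _   = contradiction z≡y z≢y
    ... | tri> z≮y _ y<z = cong₂ _+_ (χ-no (z <? y) z≮y) (χ-yes (y <? z) y<z)

-- Exchangeability of the entries under relabelling of symbols

module Exchange where

  open import Data.Nat.Base as ℕ using (ℕ; suc; _!)
  open import Data.Integer using (ℤ; +_; _+_; _*_)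
  open import Data.Integer.Properties using (*-identityˡ; pos-*)
  open import Data.Integer.Tactic.RingSolver using (solve-∀)
  open import Data.Fin.Base using (Fin)
  open import Data.Fin.Properties using (_≟_)
  open import Data.Fin.Permutation.Components using (transpose)
  open import Data.List.Base using (List; []; _∷_; _++_; map; length; allFin; drop)
  open import Data.List.Properties using (map-cong; map-++; map-∘; ++-assoc)
  open import Data.List.Relation.Unary.All using ([]; _∷_)
  import Data.List.Relation.Unary.All.Properties as Allₚ
  open import Data.List.Relation.Unary.AllPairs using ([]; _∷_)
  open import Data.List.Relation.Binary.Permutation.Propositional
    using (_↭_; refl; prep; swap; trans; ↭-refl; ↭-sym)
  import Data.List.Relation.Binary.Permutation.Propositional.Properties as ↭
  open import Data.Product.Base using (_,_; proj₁)
  open import Function.Base using (_∘_)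
  open import Relation.Binary.PropositionalEquality hiding (trans)
  import Relation.Binary.PropositionalEquality as ≡

  open Sums
  open Words

  private variable
    n : ℕ

  Extensional : {C : Set} → ((C → Fin n) → ℤ) → Set
  Extensional F = ∀ {w w'} → w ≗ w' → F w ≡ F w'

  -- Invariance of the multiset of the words ev x under swapping two letters of the alphabet, tested on
  -- extensional functionals because the words are functions.
  RelabelInvariant : {X C : Set} → List X → (X → C → Fin n) → Set
  RelabelInvariant {n} {C = C} xs ev =
    (a b : Fin n) (F : (C → Fin n) → ℤ) → Extensional F →
    (∑[ x ∈ xs ] F (transpose a b ∘ ev x)) ≡ (∑[ x ∈ xs ] F (ev x))

  ∑-δ² : (u v : Fin n) (K : Fin n → Fin n → ℤ) →
         (∑[ a ∈ allFin n ] ∑[ b ∈ allFin n ] (χ (u ≟ a) * (χ (v ≟ b) * K a b))) ≡ K u v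
  ∑-δ² {n} u v K = ≡.trans
    (∑-cong (allFin n) (λ a → ≡.trans
      (∑-*ˡ (allFin n) (χ (u ≟ a)) (λ b → χ (v ≟ b) * K a b))
      (cong (χ (u ≟ a) *_) (∑-δ v (K a)))))
    (∑-δ u (λ a → K a v))

  -- The weight demands distinct letters across both words, since only then does a swap of symbols
  -- act as a swap of positions in the first word that leaves the second one alone.
  uniqueΦ : (List (Fin n) → List (Fin n) → ℤ) → List (Fin n) → List (Fin n) → ℤ
  uniqueΦ Ψ u v = U (u ++ v) * Ψ u v

  uniqueΦ-transpose : (Ψ : List (Fin n) → List (Fin n) → ℤ) (pre : List (Fin n)) (a b : Fin n)
    (ys v : List (Fin n)) →
    uniqueΦ Ψ (map (transpose b a) (pre ++ a ∷ b ∷ ys)) (map (transpose b a) v) ≡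
    uniqueΦ Ψ (pre ++ b ∷ a ∷ ys) v
  uniqueΦ-transpose Ψ pre a b ys v = begin
    U (map τ u ++ map τ v) * Ψ (map τ u) (map τ v)
      ≡⟨ cong (_* Ψ (map τ u) (map τ v)) (≡.trans (cong U (sym (map-++ τ u v))) (U-transpose b a (u ++ v))) ⟩
    U (u ++ v) * Ψ (map τ u) (map τ v)
      ≡⟨ χ-elim _ (λ uniq → let eqᵤ , eqᵥ = map-transpose-swap pre a b ys v uniq in cong₂ Ψ eqᵤ eqᵥ) ⟩
    U (u ++ v) * Ψ (pre ++ b ∷ a ∷ ys) v
      ≡⟨ cong (_* Ψ (pre ++ b ∷ a ∷ ys) v) (U-↭ (↭.++⁺ʳ v (↭.++⁺ˡ pre (swap a b ↭-refl)))) ⟩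
    U ((pre ++ b ∷ a ∷ ys) ++ v) * Ψ (pre ++ b ∷ a ∷ ys) v ∎
    where
    open ≡-Reasoning
    τ = transpose b a
    u = pre ++ a ∷ b ∷ ys

  module _ {X C : Set} (xs : List X) (ev : X → C → Fin n) (invariant : RelabelInvariant xs ev) where

    -- The symbols to be swapped vary with `x`, while the invariance is about fixed symbols. The sum
    -- is therefore split by the values `a` at `p` and `b` at `q`. Invariance under the fixed swap
    -- of `a` and `b` turns each part into the part where these two values have changed places, and
    -- the parts add up again.
    swap-values : (F : (C → Fin n) → ℤ) → Extensional F → (p q : C) →
      (∑[ x ∈ xs ] F (ev x)) ≡ (∑[ x ∈ xs ] F (transpose (ev x p) (ev x q) ∘ ev x))
    swap-values F F-ext p q = sym (begin
      (∑[ x ∈ xs ] F (transpose (ev x p) (ev x q) ∘ ev x))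
        ≡⟨ ∑-cong xs (λ x → sym (∑-δ² (ev x p) (ev x q) (λ a b → F (transpose a b ∘ ev x)))) ⟩
      (∑[ x ∈ xs ] ∑[ a ∈ allFin n ] ∑[ b ∈ allFin n ] K a b (ev x))
        ≡⟨ ∑²-out K ⟩
      (∑[ a ∈ allFin n ] ∑[ b ∈ allFin n ] ∑[ x ∈ xs ] K a b (ev x))
        ≡⟨ ∑-cong (allFin n) (λ a → ∑-cong (allFin n) (λ b →
             ≡.trans (sym (invariant a b (K a b) (K-ext a b))) (∑-cong xs (λ x → K-transpose a b (ev x))))) ⟩
      (∑[ a ∈ allFin n ] ∑[ b ∈ allFin n ] ∑[ x ∈ xs ] (χ (ev x q ≟ a) * (χ (ev x p ≟ b) * F (ev x))))
        ≡⟨ ∑²-out (λ a b w → χ (w q ≟ a) * (χ (w p ≟ b) * F w)) ⟨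
      (∑[ x ∈ xs ] ∑[ a ∈ allFin n ] ∑[ b ∈ allFin n ] (χ (ev x q ≟ a) * (χ (ev x p ≟ b) * F (ev x))))
        ≡⟨ ∑-cong xs (λ x → ∑-δ² (ev x q) (ev x p) (λ _ _ → F (ev x))) ⟩
      (∑[ x ∈ xs ] F (ev x)) ∎)
      where
      open ≡-Reasoning
      K : Fin n → Fin n → (C → Fin n) → ℤ
      K a b w = χ (w p ≟ a) * (χ (w q ≟ b) * F (transpose a b ∘ w))

      ∑²-out : (K : Fin n → Fin n → (C → Fin n) → ℤ) →
        (∑[ x ∈ xs ] ∑[ a ∈ allFin n ] ∑[ b ∈ allFin n ] K a b (ev x)) ≡
        (∑[ a ∈ allFin n ] ∑[ b ∈ allFin n ] ∑[ x ∈ xs ] K a b (ev x))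
      ∑²-out K = ≡.trans (∑-swap xs (allFin n) (λ x a → ∑[ b ∈ allFin n ] K a b (ev x)))
        (∑-cong (allFin n) (λ a → ∑-swap xs (allFin n) (λ x b → K a b (ev x))))

      K-ext : ∀ a b → Extensional (K a b)
      K-ext a b eq = cong₂ _*_ (cong (λ c → χ (c ≟ a)) (eq p))
        (cong₂ _*_ (cong (λ c → χ (c ≟ b)) (eq q)) (F-ext (λ c → cong (transpose a b) (eq c))))

      K-transpose : ∀ a b w → K a b (transpose a b ∘ w) ≡ χ (w q ≟ a) * (χ (w p ≟ b) * F w)
      K-transpose a b w = begin
        χ (transpose a b (w p) ≟ a) * (χ (transpose a b (w q) ≟ b) * F (transpose a b ∘ transpose a b ∘ w))
          ≡⟨ cong₂ _*_ (moves (w p) a b (transpose-left a b) (transpose-right a b))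
               (cong₂ _*_ (moves (w q) b a (transpose-right a b) (transpose-left a b))
                 (F-ext (λ c → transpose-involutive a b (w c)))) ⟩
        χ (w p ≟ b) * (χ (w q ≟ a) * F w)
          ≡⟨ comm (χ (w p ≟ b)) (χ (w q ≟ a)) (F w) ⟩
        χ (w q ≟ a) * (χ (w p ≟ b) * F w) ∎
        where
        comm : ∀ x y z → x * (y * z) ≡ y * (x * z)
        comm = solve-∀
        moves : ∀ v c d → transpose a b c ≡ d → transpose a b d ≡ c → χ (transpose a b v ≟ c) ≡ χ (v ≟ d)
        moves v c d c↦d d↦c = χ-⇔ _ _
          (λ e → ≡.trans (transpose-adjoint a b v c e) c↦d)
          (λ e → ≡.trans (cong (transpose a b) e) d↦c)

    -- Adjacent exchanges generate all rearrangements of the cells. Under the distinctness weight,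
    -- exchanging two neighbouring cells has the same effect as exchanging their values, which
    -- `swap-values` permits.
    exchangeable : (Ψ : List (Fin n) → List (Fin n) → ℤ) (rest : List C) {cs cs' : List C} → cs ↭ cs' →
      (∑[ x ∈ xs ] uniqueΦ Ψ (map (ev x) cs) (map (ev x) rest)) ≡
      (∑[ x ∈ xs ] uniqueΦ Ψ (map (ev x) cs') (map (ev x) rest))
    exchangeable Ψ rest = go []
      where
      open ≡-Reasoning
      S : List C → ℤ
      S cs = ∑[ x ∈ xs ] uniqueΦ Ψ (map (ev x) cs) (map (ev x) rest)

      adjacent : ∀ pre p q ys → S (pre ++ p ∷ q ∷ ys) ≡ S (pre ++ q ∷ p ∷ ys)
      adjacent pre p q ys = begin
        S (pre ++ p ∷ q ∷ ys)
          ≡⟨ swap-values (λ w → uniqueΦ Ψ (map w (pre ++ p ∷ q ∷ ys)) (map w rest))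
               (λ eq → cong₂ (uniqueΦ Ψ) (map-cong eq (pre ++ p ∷ q ∷ ys)) (map-cong eq rest)) q p ⟩
        (∑[ x ∈ xs ] uniqueΦ Ψ (map (transpose (ev x q) (ev x p) ∘ ev x) (pre ++ p ∷ q ∷ ys))
                               (map (transpose (ev x q) (ev x p) ∘ ev x) rest))
          ≡⟨ ∑-cong xs (λ x → swapped (ev x)) ⟩
        S (pre ++ q ∷ p ∷ ys) ∎
        where
        swapped : ∀ w → let τ = transpose (w q) (w p) in
          uniqueΦ Ψ (map (τ ∘ w) (pre ++ p ∷ q ∷ ys)) (map (τ ∘ w) rest) ≡
          uniqueΦ Ψ (map w (pre ++ q ∷ p ∷ ys)) (map w rest)
        swapped w = begin
          uniqueΦ Ψ (map (τ ∘ w) (pre ++ p ∷ q ∷ ys)) (map (τ ∘ w) rest)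
            ≡⟨ cong₂ (uniqueΦ Ψ) (≡.trans (map-∘ (pre ++ p ∷ q ∷ ys)) (cong (map τ) (map-++ w pre (p ∷ q ∷ ys))))
                 (map-∘ rest) ⟩
          uniqueΦ Ψ (map τ (map w pre ++ w p ∷ w q ∷ map w ys)) (map τ (map w rest))
            ≡⟨ uniqueΦ-transpose Ψ (map w pre) (w p) (w q) (map w ys) (map w rest) ⟩
          uniqueΦ Ψ (map w pre ++ w q ∷ w p ∷ map w ys) (map w rest)
            ≡⟨ cong (λ u → uniqueΦ Ψ u (map w rest)) (map-++ w pre (q ∷ p ∷ ys)) ⟨
          uniqueΦ Ψ (map w (pre ++ q ∷ p ∷ ys)) (map w rest) ∎
          where τ = transpose (w q) (w p)

      -- The prefix collects the cells that lie before the part still being rearranged, since the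
      -- adjacent exchange may take place deep inside the list.
      go : ∀ pre {cs cs'} → cs ↭ cs' → S (pre ++ cs) ≡ S (pre ++ cs')
      go pre refl = refl
      go pre (prep {cs} {cs'} p r) = begin
        S (pre ++ p ∷ cs)          ≡⟨ cong S (++-assoc pre (p ∷ []) cs) ⟨
        S ((pre ++ p ∷ []) ++ cs)  ≡⟨ go (pre ++ p ∷ []) r ⟩
        S ((pre ++ p ∷ []) ++ cs') ≡⟨ cong S (++-assoc pre (p ∷ []) cs') ⟩
        S (pre ++ p ∷ cs')         ∎
      go pre (swap {cs} {cs'} p q r) = begin
        S (pre ++ p ∷ q ∷ cs)          ≡⟨ cong S (++-assoc pre (p ∷ q ∷ []) cs) ⟨
        S ((pre ++ p ∷ q ∷ []) ++ cs)  ≡⟨ go (pre ++ p ∷ q ∷ []) r ⟩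
        S ((pre ++ p ∷ q ∷ []) ++ cs') ≡⟨ cong S (++-assoc pre (p ∷ q ∷ []) cs') ⟩
        S (pre ++ p ∷ q ∷ cs')         ≡⟨ adjacent pre p q cs' ⟩
        S (pre ++ q ∷ p ∷ cs')         ∎
      go pre (trans r s) = ≡.trans (go pre r) (go pre s)

    -- Inserting the letter at c among the increasing letters at cs splits the count into 1 + length cs parts,
    -- which are equal by exchangeability.
    increasing-count : (g : List (Fin n) → ℤ) (cs rest : List C) →
      + (length cs !) * (∑[ x ∈ xs ] uniqueΦ (λ u v → inc u * g v) (map (ev x) cs) (map (ev x) rest)) ≡
      (∑[ x ∈ xs ] uniqueΦ (λ _ v → g v) (map (ev x) cs) (map (ev x) rest))
    increasing-count g [] rest =
      ≡.trans (*-identityˡ _) (∑-cong xs (λ x → cong (U (map (ev x) rest) *_)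
        (≡.trans (cong (_* g (map (ev x) rest)) (χ-yes _ [])) (*-identityˡ _))))
    increasing-count g (c ∷ cs) rest = begin
      + (suc m ℕ.* m !) * Q (c ∷ cs)
        ≡⟨ cong (_* Q (c ∷ cs)) (pos-* (suc m) (m !)) ⟩
      + suc m * + (m !) * Q (c ∷ cs)
        ≡⟨ assoc-comm (+ suc m) (+ (m !)) (Q (c ∷ cs)) ⟩
      + (m !) * (+ suc m * Q (c ∷ cs))
        ≡⟨ cong (+ (m !) *_) (begin
             + suc m * Q (c ∷ cs)
               ≡⟨ insΣ-const (Q (c ∷ cs)) c cs ⟨
             insΣ (λ _ → Q (c ∷ cs)) c cs
               ≡⟨ insΣ-cong c cs (λ r → exchangeable (λ u v → inc u * g v) rest (↭-sym r)) ⟩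
             insΣ Q c cs
               ≡⟨ insΣ-∑ xs (λ x r → uniqueΦ (λ u v → inc u * g v) (map (ev x) r) (map (ev x) rest)) c cs ⟩
             (∑[ x ∈ xs ] insΣ (λ r → uniqueΦ (λ u v → inc u * g v) (map (ev x) r) (map (ev x) rest)) c cs)
               ≡⟨ ∑-cong xs (λ x → ≡.trans
                    (insΣ-map (ev x) (λ u → uniqueΦ (λ u v → inc u * g v) u (map (ev x) rest)) c cs)
                    (insert (ev x c) (map (ev x) cs) (map (ev x) rest))) ⟩
             -- The letter at `c` is no longer ordered but must remain distinct from the others, so
             -- it moves to the head of the second word; `drop 1` hides it from `g`.
             (∑[ x ∈ xs ] uniqueΦ (λ u v → inc u * g (drop 1 v)) (map (ev x) cs) (map (ev x) (c ∷ rest))) ∎) ⟩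
      + (m !) * (∑[ x ∈ xs ] uniqueΦ (λ u v → inc u * g (drop 1 v)) (map (ev x) cs) (map (ev x) (c ∷ rest)))
        ≡⟨ increasing-count (g ∘ drop 1) cs (c ∷ rest) ⟩
      (∑[ x ∈ xs ] uniqueΦ (λ _ v → g (drop 1 v)) (map (ev x) cs) (map (ev x) (c ∷ rest)))
        ≡⟨ ∑-cong xs (λ x → cong (_* g (map (ev x) rest))
             (U-↭ (↭.shift (ev x c) (map (ev x) cs) (map (ev x) rest)))) ⟩
      (∑[ x ∈ xs ] uniqueΦ (λ _ v → g v) (map (ev x) (c ∷ cs)) (map (ev x) rest)) ∎
      where
      open ≡-Reasoning
      m = length cs
      Q : List C → ℤ
      Q r = ∑[ x ∈ xs ] uniqueΦ (λ u v → inc u * g v) (map (ev x) r) (map (ev x) rest)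

      assoc-comm : ∀ x y z → x * y * z ≡ y * (x * z)
      assoc-comm = solve-∀

      rearrange : ∀ x y z → x * (y * z) ≡ x * z * y
      rearrange = solve-∀

      insert : ∀ z zs v → insΣ (λ u → U (u ++ v) * (inc u * g v)) z zs ≡ U (zs ++ z ∷ v) * (inc zs * g v)
      insert z zs v = begin
        insΣ (λ u → U (u ++ v) * (inc u * g v)) z zs
          ≡⟨ insΣ-cong z zs (λ {u} r → ≡.trans (cong (_* (inc u * g v)) (U-↭ (↭.++⁺ʳ v r)))
               (rearrange (U (z ∷ zs ++ v)) (inc u) (g v))) ⟩
        insΣ (λ u → U (z ∷ zs ++ v) * g v * inc u) z zs
          ≡⟨ insΣ-*ˡ (U (z ∷ zs ++ v) * g v) inc z zs ⟩
        U (z ∷ zs ++ v) * g v * insΣ inc z zs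
          ≡⟨ sym (rearrange (U (z ∷ zs ++ v)) (insΣ inc z zs) (g v)) ⟩
        U (z ∷ zs ++ v) * (insΣ inc z zs * g v)
          -- The distinctness weight supplies the freshness of `z` that `insΣ-inc` asks for.
          ≡⟨ χ-elim _ (λ { (z≢ ∷ _) → cong (_* g v) (insΣ-inc z zs (proj₁ (Allₚ.++⁻ zs z≢))) }) ⟩
        U (z ∷ zs ++ v) * (inc zs * g v)
          ≡⟨ cong (_* (inc zs * g v)) (U-↭ (↭-sym (↭.shift z zs v))) ⟩
        U (zs ++ z ∷ v) * (inc zs * g v) ∎

-- Lists of all functions, and the number of increasing sequences

module Functions where

  open import Data.Nat.Base as ℕ using (ℕ; zero; suc; _!; _^_; _∸_)
  import Data.Nat.Properties as ℕ
  open import Data.Nat.Combinatorics using (_C_; nCk≡n!/k![n-k]!; k![n∸k]!∣n!)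
  open import Data.Nat.DivMod using (_/_; m/n*n≡m)
  open import Data.Integer using (ℤ; 0ℤ; 1ℤ; +_; _+_; _*_; _-_; _≤_; +≤+; nonNegative)
  open import Data.Integer.Properties
    using (*-identityˡ; *-identityʳ; *-assoc; +-identityʳ; pos-*; ⊖-≥; m-n≡m⊖n; ≤-reflexive;
           *-monoˡ-≤-nonNeg; *-monoʳ-≤-nonNeg; +-injective; module ≤-Reasoning)
  open import Data.Integer.Tactic.RingSolver using (solve-∀)
  open import Data.Fin.Base using (Fin; zero; suc; _<_)
  open import Data.Fin.Properties as Fin using (_≟_)
  open import Data.Fin.Permutation.Components using (transpose)
  open import Data.List.Base using (List; []; _∷_; _++_; map; length; allFin; tabulate)
  open import Data.List.Properties using (map-tabulate; length-tabulate; ++-identityʳ)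
  open import Data.List.Relation.Unary.All as All using ([]; _∷_)
  import Data.List.Relation.Unary.All.Properties as Allₚ
  open import Data.List.Relation.Unary.Any as Any using (Any; here)
  import Data.List.Relation.Unary.Any.Properties as Anyₚ
  open import Data.List.Relation.Unary.AllPairs as AllPairs using (AllPairs; []; _∷_; allPairs?)
  import Data.List.Relation.Unary.AllPairs.Properties as AllPairsₚ
  open import Data.List.Relation.Unary.Unique.Propositional using (Unique)
  open import Data.List.Relation.Unary.Unique.DecPropositional using (unique?)
  open import Data.Product.Base using (_×_; _,_)
  open import Data.Vec.Functional as VF using (updateAt)
  open import Function.Base using (_∘_; id)
  open import Relation.Nullary using (yes; no)
  open import Relation.Nullary.Decidable using (_×-dec_)
  open import Relation.Binary.PropositionalEquality

  open Sums
  open Words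
  open Exchange

  private variable
    A : Set
    n : ℕ

  ∑-allFuns-suc : (k : ℕ) (xs : List A) (f : (Fin (suc k) → A) → ℤ) →
    ∑ (allFuns (suc k) xs) f ≡ (∑[ a ∈ xs ] ∑[ y ∈ allFuns k xs ] f (a VF.∷ y))
  ∑-allFuns-suc k xs f = trans
    (∑-concatMap (λ a → map (a VF.∷_) (allFuns k xs)) xs f)
    (∑-cong xs (λ a → ∑-map (a VF.∷_) (allFuns k xs) f))

  ∑-allFuns-const : (k : ℕ) (xs : List A) (c : ℤ) → (∑[ _ ∈ allFuns k xs ] c) ≡ + (length xs ^ k) * c
  ∑-allFuns-const zero    xs c = trans (+-identityʳ c) (sym (*-identityˡ c))
  ∑-allFuns-const (suc k) xs c = begin
    (∑[ _ ∈ allFuns (suc k) xs ] c)          ≡⟨ ∑-allFuns-suc k xs (λ _ → c) ⟩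
    (∑[ _ ∈ xs ] ∑[ _ ∈ allFuns k xs ] c)    ≡⟨ ∑-const xs _ ⟩
    + length xs * (∑[ _ ∈ allFuns k xs ] c)  ≡⟨ cong (+ length xs *_) (∑-allFuns-const k xs c) ⟩
    + length xs * (+ (length xs ^ k) * c)    ≡⟨ *-assoc (+ length xs) _ c ⟨
    + length xs * + (length xs ^ k) * c      ≡⟨ cong (_* c) (pos-* (length xs) _) ⟨
    + (length xs ^ suc k) * c                ∎
    where open ≡-Reasoning

  -- Resampling one coordinate: overwriting the value at `j` by all `c` produces every function once
  -- for each value that was overwritten, whence the factor `length xs`.
  ∑-allFuns-updateAt : {k : ℕ} (xs : List A) (j : Fin k) (F : (Fin k → A) → ℤ) →
    (∀ {y z} → y ≗ z → F y ≡ F z) →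
    + length xs * ∑ (allFuns k xs) F ≡ (∑[ y ∈ allFuns k xs ] ∑[ c ∈ xs ] F (updateAt y j (λ _ → c)))
  ∑-allFuns-updateAt {k = suc k} xs zero F F-ext = begin
    + length xs * ∑ (allFuns (suc k) xs) F
      ≡⟨ cong (+ length xs *_) (trans (∑-allFuns-suc k xs F) (∑-swap xs (allFuns k xs) (λ c y → F (c VF.∷ y)))) ⟩
    + length xs * (∑[ y ∈ allFuns k xs ] ∑[ c ∈ xs ] F (c VF.∷ y))
      ≡⟨ ∑-const xs _ ⟨
    (∑[ a ∈ xs ] ∑[ y ∈ allFuns k xs ] ∑[ c ∈ xs ] F (c VF.∷ y))
      ≡⟨ ∑-cong xs (λ a → ∑-cong (allFuns k xs) (λ y → ∑-cong xs (λ c →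
           F-ext (λ { zero → refl ; (suc i) → refl })))) ⟩
    (∑[ a ∈ xs ] ∑[ y ∈ allFuns k xs ] ∑[ c ∈ xs ] F (updateAt (a VF.∷ y) zero (λ _ → c)))
      ≡⟨ ∑-allFuns-suc k xs (λ y → ∑[ c ∈ xs ] F (updateAt y zero (λ _ → c))) ⟨
    (∑[ y ∈ allFuns (suc k) xs ] ∑[ c ∈ xs ] F (updateAt y zero (λ _ → c))) ∎
    where open ≡-Reasoning
  ∑-allFuns-updateAt {k = suc k} xs (suc j) F F-ext = begin
    + length xs * ∑ (allFuns (suc k) xs) F
      ≡⟨ cong (+ length xs *_) (∑-allFuns-suc k xs F) ⟩
    + length xs * (∑[ a ∈ xs ] ∑[ y ∈ allFuns k xs ] F (a VF.∷ y))
      ≡⟨ ∑-*ˡ xs (+ length xs) (λ a → ∑[ y ∈ allFuns k xs ] F (a VF.∷ y)) ⟨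
    (∑[ a ∈ xs ] (+ length xs * (∑[ y ∈ allFuns k xs ] F (a VF.∷ y))))
      ≡⟨ ∑-cong xs (λ a → ∑-allFuns-updateAt xs j (λ y → F (a VF.∷ y))
           (λ eq → F-ext (λ { zero → refl ; (suc i) → eq i }))) ⟩
    (∑[ a ∈ xs ] ∑[ y ∈ allFuns k xs ] ∑[ c ∈ xs ] F (a VF.∷ updateAt y j (λ _ → c)))
      ≡⟨ ∑-cong xs (λ a → ∑-cong (allFuns k xs) (λ y → ∑-cong xs (λ c →
           F-ext (λ { zero → refl ; (suc i) → refl })))) ⟩
    (∑[ a ∈ xs ] ∑[ y ∈ allFuns k xs ] ∑[ c ∈ xs ] F (updateAt (a VF.∷ y) (suc j) (λ _ → c)))
      ≡⟨ ∑-allFuns-suc k xs (λ y → ∑[ c ∈ xs ] F (updateAt y (suc j) (λ _ → c))) ⟨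
    (∑[ y ∈ allFuns (suc k) xs ] ∑[ c ∈ xs ] F (updateAt y (suc j) (λ _ → c))) ∎
    where open ≡-Reasoning

  -- allFuns lists each function only up to pointwise equality; ≈ is the equality already accepted
  -- on the values.
  allFuns-complete : {_≈_ : A → A → Set} {k : ℕ} (xs : List A) (g : Fin k → A) →
    (∀ i → Any (_≈ g i) xs) → Any (λ y → ∀ i → y i ≈ g i) (allFuns k xs)
  allFuns-complete {k = zero}  xs g g∈ = here (λ ())
  allFuns-complete {_≈_ = _≈_} {k = suc k} xs g g∈ = Anyₚ.concatMap⁺ (λ a → map (a VF.∷_) (allFuns k xs))
    (Any.map (λ a≈ → Anyₚ.map⁺ (Any.map (λ y≈ → λ { zero → a≈ ; (suc i) → y≈ i })
                                  (allFuns-complete {_≈_ = _≈_} xs (g ∘ suc) (g∈ ∘ suc))))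
      (g∈ zero))

  -- Says that `φ` permutes `xs` up to `≈`, tested on functionals that respect `≈`. In this form the
  -- property passes from a list to the functions with values in it, and by a second passage to
  -- square matrices.
  ∑-Invariant : (A → A → Set) → List A → (A → A) → Set
  ∑-Invariant {A} _≈_ xs φ = (f : A → ℤ) → (∀ {x y} → x ≈ y → f x ≡ f y) → ∑ xs (f ∘ φ) ≡ ∑ xs f

  allFuns-invariant : {_≈_ : A → A → Set} {xs : List A} {φ : A → A} (k : ℕ) → (∀ {x} → x ≈ x) →
    ∑-Invariant _≈_ xs φ → ∑-Invariant (λ y z → (i : Fin k) → y i ≈ z i) (allFuns k xs) (φ ∘_)
  allFuns-invariant zero    ≈-refl inv f f-resp = cong (_+ 0ℤ) (f-resp (λ ()))
  allFuns-invariant {_≈_ = _≈_} {xs} {φ} (suc k) ≈-refl inv f f-resp = begin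
    ∑ (allFuns (suc k) xs) (f ∘ (φ ∘_))
      ≡⟨ ∑-allFuns-suc k xs (f ∘ (φ ∘_)) ⟩
    (∑[ a ∈ xs ] ∑[ y ∈ allFuns k xs ] f (φ ∘ (a VF.∷ y)))
      ≡⟨ ∑-cong xs (λ a → ∑-cong (allFuns k xs) (λ y → f-resp (λ { zero → ≈-refl ; (suc i) → ≈-refl }))) ⟩
    (∑[ a ∈ xs ] ∑[ y ∈ allFuns k xs ] f (φ a VF.∷ φ ∘ y))
      ≡⟨ ∑-cong xs (λ a → allFuns-invariant k ≈-refl inv (λ y → f (φ a VF.∷ y))
           (λ eq → f-resp (λ { zero → ≈-refl ; (suc i) → eq i }))) ⟩
    (∑[ a ∈ xs ] ∑[ y ∈ allFuns k xs ] f (φ a VF.∷ y))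
      ≡⟨ inv (λ a → ∑[ y ∈ allFuns k xs ] f (a VF.∷ y))
           (λ eq → ∑-cong (allFuns k xs) (λ y → f-resp (λ { zero → eq ; (suc i) → ≈-refl }))) ⟩
    (∑[ a ∈ xs ] ∑[ y ∈ allFuns k xs ] f (a VF.∷ y))
      ≡⟨ ∑-allFuns-suc k xs f ⟨
    ∑ (allFuns (suc k) xs) f ∎
    where open ≡-Reasoning

  transpose-invariant : (a b : Fin n) → ∑-Invariant _≡_ (allFin n) (transpose a b)
  transpose-invariant a b f _ =
    ∑-inverse (transpose a b) (transpose a b) (transpose-involutive a b) (transpose-involutive a b) f

  functions-relabelInvariant : (n k : ℕ) → RelabelInvariant (allFuns k (allFin n)) id
  functions-relabelInvariant n k a b = allFuns-invariant k refl (transpose-invariant a b)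

  tabulate-AllPairs⁻ : {R : A → A → Set} {k : ℕ} {f : Fin k → A} → AllPairs R (tabulate f) →
    {i j : Fin k} → i < j → R (f i) (f j)
  tabulate-AllPairs⁻ {f = f} (Rf ∷ _)  {zero}  {suc j} i<j = Allₚ.tabulate⁻ Rf j
  tabulate-AllPairs⁻         (_  ∷ Rf) {suc i} {suc j} i<j = tabulate-AllPairs⁻ Rf (ℕ.s<s⁻¹ i<j)

  strictInc-inc : {k : ℕ} (y : Fin k → Fin n) → χ (strictInc? y) ≡ inc (map y (allFin k))
  strictInc-inc {k = k} y = trans
    (χ-⇔ _ (allPairs? Fin._<?_ (tabulate y))
      (λ y< → AllPairsₚ.tabulate⁺-< (y< _ _))
      (λ y< i j → tabulate-AllPairs⁻ y<))
    (cong inc (sym (map-tabulate id y)))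

  inc⇒U : (u : List (Fin n)) → U u * inc u ≡ inc u
  inc⇒U u = trans (sym (χ-× (unique? _≟_ u) _))
    (χ-⇔ _ _ (λ (_ , u<) → u<) (λ u< → AllPairs.map Fin.<⇒≢ u< , u<))

  injections : (n k : ℕ) → ℤ
  injections n k = ∑[ y ∈ allFuns k (allFin n) ] U (map y (allFin k))

  -- The exchange argument with functions in place of Latin squares: a function is its own word, and
  -- of the `k !` orders of its distinct values exactly one is increasing.
  k!*incSeqs : (n k : ℕ) → + (k !) * + length (incSeqs n k) ≡ injections n k
  k!*incSeqs n k = begin
    + (k !) * + length (incSeqs n k)
      ≡⟨ cong₂ _*_ (cong (λ l → + (l !)) (sym (length-tabulate {n = k} id)))
           (trans (length-filter≡∑ strictInc? (allFuns k (allFin n)))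
             (∑-cong (allFuns k (allFin n)) (λ y → trans (strictInc-inc y) (sym (simplify y))))) ⟩
    + (length (allFin k) !) * (∑[ y ∈ allFuns k (allFin n) ] uniqueΦ (λ u v → inc u * 1ℤ) (map y (allFin k)) [])
      ≡⟨ increasing-count (allFuns k (allFin n)) id (functions-relabelInvariant n k) (λ _ → 1ℤ) (allFin k) [] ⟩
    (∑[ y ∈ allFuns k (allFin n) ] uniqueΦ (λ _ _ → 1ℤ) (map y (allFin k)) [])
      ≡⟨ ∑-cong (allFuns k (allFin n)) (λ y → trans (*-identityʳ _) (cong U (++-identityʳ _))) ⟩
    injections n k ∎
    where
    open ≡-Reasoning
    simplify : ∀ y → uniqueΦ (λ u v → inc u * 1ℤ) (map y (allFin k)) [] ≡ inc (map y (allFin k))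
    simplify y = trans (cong₂ _*_ (cong U (++-identityʳ _)) (*-identityʳ _)) (inc⇒U _)

  ∑-fresh : (u : List (Fin n)) → Unique u → (∑[ a ∈ allFin n ] χ (fresh? a u)) + + length u ≡ + n
  ∑-fresh {n} [] [] = begin
    (∑[ a ∈ allFin n ] χ (fresh? a [])) + 0ℤ
      ≡⟨ +-identityʳ _ ⟩
    (∑[ a ∈ allFin n ] χ (fresh? a []))
      ≡⟨ ∑-cong (allFin n) (λ a → χ-yes (fresh? a []) []) ⟩
    (∑[ a ∈ allFin n ] 1ℤ)
      ≡⟨ ∑-allFin-const n 1ℤ ⟩
    + n * 1ℤ
      ≡⟨ *-identityʳ _ ⟩
    + n ∎
    where open ≡-Reasoning
  ∑-fresh {n} (b ∷ u) (b≢u ∷ uniq) = begin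
    (∑[ a ∈ allFin n ] χ (fresh? a (b ∷ u))) + (1ℤ + + length u)
      ≡⟨ cong (λ s → (∑[ a ∈ allFin n ] χ (fresh? a (b ∷ u))) + (s + + length u)) (∑-δ b (λ _ → 1ℤ)) ⟨
    (∑[ a ∈ allFin n ] χ (fresh? a (b ∷ u))) + ((∑[ a ∈ allFin n ] (χ (b ≟ a) * 1ℤ)) + + length u)
      ≡⟨ assoc (∑[ a ∈ allFin n ] χ (fresh? a (b ∷ u))) (∑[ a ∈ allFin n ] (χ (b ≟ a) * 1ℤ)) (+ length u) ⟩
    (∑[ a ∈ allFin n ] χ (fresh? a (b ∷ u))) + (∑[ a ∈ allFin n ] (χ (b ≟ a) * 1ℤ)) + + length u
      ≡⟨ cong (_+ + length u) (∑-+ (allFin n) _ _) ⟨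
    (∑[ a ∈ allFin n ] (χ (fresh? a (b ∷ u)) + χ (b ≟ a) * 1ℤ)) + + length u
      ≡⟨ cong (_+ + length u) (∑-cong (allFin n) step) ⟩
    (∑[ a ∈ allFin n ] χ (fresh? a u)) + + length u
      ≡⟨ ∑-fresh u uniq ⟩
    + n ∎
    where
    open ≡-Reasoning
    assoc : ∀ x y z → x + (y + z) ≡ x + y + z
    assoc = solve-∀
    step : ∀ a → χ (fresh? a (b ∷ u)) + χ (b ≟ a) * 1ℤ ≡ χ (fresh? a u)
    step a with b ≟ a
    ... | yes refl = trans
            (cong₂ _+_ (χ-no (fresh? b (b ∷ u)) (λ { (b≢b ∷ _) → b≢b refl }))
                       (trans (*-identityʳ _) (χ-yes (yes refl) refl)))
            (sym (χ-yes (fresh? b u) b≢u))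
    ... | no b≢a = trans
            (cong₂ _+_ (χ-⇔ (fresh? a (b ∷ u)) (fresh? a u)
                          (λ { (_ ∷ a≢u) → a≢u }) (λ a≢u → (b≢a ∘ sym) ∷ a≢u))
                       (trans (*-identityʳ _) (χ-no (no b≢a) b≢a)))
            (+-identityʳ _)

  -- The head is one of the `n - k` letters that the tail omits. For `k` above `n` the factor is
  -- negative, but then `injections n k` is zero.
  injections-suc : (n k : ℕ) → injections n (suc k) ≡ injections n k * (+ n - + k)
  injections-suc n k = begin
    injections n (suc k)
      ≡⟨ ∑-allFuns-suc k (allFin n) (λ y → U (map y (allFin (suc k)))) ⟩
    (∑[ a ∈ allFin n ] ∑[ y ∈ allFuns k (allFin n) ] U (map (a VF.∷ y) (allFin (suc k))))
      ≡⟨ ∑-cong (allFin n) (λ a → ∑-cong (allFuns k (allFin n)) (split a)) ⟩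
    (∑[ a ∈ allFin n ] ∑[ y ∈ allFuns k (allFin n) ] (U (map y (allFin k)) * χ (fresh? a (map y (allFin k)))))
      ≡⟨ ∑-swap (allFin n) (allFuns k (allFin n)) _ ⟩
    (∑[ y ∈ allFuns k (allFin n) ] ∑[ a ∈ allFin n ] (U (map y (allFin k)) * χ (fresh? a (map y (allFin k)))))
      ≡⟨ ∑-cong (allFuns k (allFin n)) (λ y → trans
           (∑-*ˡ (allFin n) (U (map y (allFin k))) _)
           (χ-elim _ (λ uniq → solve-fresh y (∑-fresh (map y (allFin k)) uniq)))) ⟩
    (∑[ y ∈ allFuns k (allFin n) ] (U (map y (allFin k)) * (+ n - + k)))
      ≡⟨ ∑-*ʳ (allFuns k (allFin n)) _ (+ n - + k) ⟩
    injections n k * (+ n - + k) ∎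
    where
    open ≡-Reasoning
    split : ∀ a y → U (map (a VF.∷ y) (allFin (suc k))) ≡
                    U (map y (allFin k)) * χ (fresh? a (map y (allFin k)))
    split a y = begin
      U (map (a VF.∷ y) (allFin (suc k)))
        ≡⟨ cong (λ u → U (a ∷ u)) (trans (map-tabulate suc (a VF.∷ y)) (sym (map-tabulate id y))) ⟩
      U (a ∷ map y (allFin k))
        ≡⟨ χ-⇔ _ (unique? _≟_ (map y (allFin k)) ×-dec fresh? a (map y (allFin k)))
             (λ { (p ∷ q) → q , p }) (λ { (q , p) → p ∷ q }) ⟩
      _ ≡⟨ χ-× _ _ ⟩
      U (map y (allFin k)) * χ (fresh? a (map y (allFin k))) ∎
    cancel : ∀ s l → s ≡ s + l - l
    cancel = solve-∀
    solve-fresh : ∀ y {s} → s + + length (map y (allFin k)) ≡ + n → s ≡ + n - + k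
    solve-fresh y {s} eq = begin
      s                  ≡⟨ cancel s (+ k) ⟩
      s + + k - + k      ≡⟨ cong (λ l → s + + l - + k) (trans (cong length (map-tabulate id y)) (length-tabulate y)) ⟨
      s + + length (map y (allFin k)) - + k ≡⟨ cong (_- + k) eq ⟩
      + n - + k          ∎

  pos-∸ : {m n : ℕ} → n ℕ.≤ m → + m - + n ≡ + (m ∸ n)
  pos-∸ {m} {n} n≤m = trans (m-n≡m⊖n m n) (⊖-≥ n≤m)

  injections-factorial : {n k : ℕ} → k ℕ.≤ n → injections n k * + ((n ∸ k) !) ≡ + (n !)
  injections-factorial {n} {zero}  _   =
    trans (cong (_* + (n !)) (trans (+-identityʳ _) (χ-yes (unique? _≟_ []) []))) (*-identityˡ _)
  injections-factorial {n} {suc k} k<n = begin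
    injections n (suc k) * + ((n ∸ suc k) !)
      ≡⟨ cong (_* + ((n ∸ suc k) !)) (trans (injections-suc n k) (cong (injections n k *_) (pos-∸ (ℕ.<⇒≤ k<n)))) ⟩
    injections n k * + (n ∸ k) * + ((n ∸ suc k) !)
      ≡⟨ *-assoc (injections n k) _ _ ⟩
    injections n k * (+ (n ∸ k) * + ((n ∸ suc k) !))
      ≡⟨ cong (injections n k *_) (trans (sym (pos-* (n ∸ k) _)) (cong +_ unfold)) ⟩
    injections n k * + ((n ∸ k) !)
      ≡⟨ injections-factorial (ℕ.<⇒≤ k<n) ⟩
    + (n !) ∎
    where
    open ≡-Reasoning
    unfold : (n ∸ k) ℕ.* (n ∸ suc k) ! ≡ (n ∸ k) !
    unfold rewrite ℕ.+-∸-assoc 1 k<n = refl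

  -- Identifies the binomial coefficients in the definition of `t` with the lists over which the
  -- proof sums. Multiplied by `k ! * (n ∸ k) !`, both sides become `n !`.
  length-incSeqs : {n k : ℕ} → k ℕ.≤ n → length (incSeqs n k) ≡ n C k
  length-incSeqs {n} {k} k≤n = ℕ.*-cancelʳ-≡ (length (incSeqs n k)) (n C k) (k ! ℕ.* (n ∸ k) !) (trans
    (+-injective (begin
      + (length (incSeqs n k) ℕ.* (k ! ℕ.* (n ∸ k) !))
        ≡⟨ trans (pos-* (length (incSeqs n k)) _) (cong (+ length (incSeqs n k) *_) (pos-* (k !) _)) ⟩
      + length (incSeqs n k) * (+ (k !) * + ((n ∸ k) !))
        ≡⟨ rotate (+ length (incSeqs n k)) (+ (k !)) _ ⟩
      + (k !) * + length (incSeqs n k) * + ((n ∸ k) !)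
        ≡⟨ cong (_* + ((n ∸ k) !)) (k!*incSeqs n k) ⟩
      injections n k * + ((n ∸ k) !)
        ≡⟨ injections-factorial k≤n ⟩
      + (n !) ∎))
    (sym (trans (cong (ℕ._* (k ! ℕ.* (n ∸ k) !)) (nCk≡n!/k![n-k]! k≤n)) (m/n*n≡m (k![n∸k]!∣n! k≤n)))))
    where
    open ≡-Reasoning
    instance _ = k ℕ.!* (n ∸ k) !≢0
    rotate : ∀ x y z → x * (y * z) ≡ y * x * z
    rotate = solve-∀

  injections≥0 : (n k : ℕ) → 0ℤ ≤ injections n k
  injections≥0 n k = ∑-nonneg (allFuns k (allFin n)) (λ y → χ≥0 (unique? _≟_ (map y (allFin k))))

  -- For `2 * k ≤ n` every factor of the falling factorial is at least half of `n`, which costs one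
  -- factor 2 per coordinate.
  ^≤injections : (n k : ℕ) → 2 ℕ.* k ℕ.≤ n → + (n ^ k) ≤ + (2 ^ k) * injections n k
  ^≤injections n zero    _    =
    ≤-reflexive (sym (trans (*-identityˡ _) (trans (+-identityʳ _) (χ-yes (unique? _≟_ []) []))))
  ^≤injections n (suc k) 2k≤n = begin
    + (n ^ suc k)
      ≡⟨ pos-* n _ ⟩
    + n * + (n ^ k)
      ≤⟨ *-monoˡ-≤-nonNeg (+ n) (^≤injections n k 2k≤n') ⟩
    + n * (+ (2 ^ k) * injections n k)
      ≡⟨ rotate (+ n) (+ (2 ^ k)) (injections n k) ⟩
    + (2 ^ k) * (injections n k * + n)
      ≤⟨ *-monoˡ-≤-nonNeg (+ (2 ^ k)) (*-monoˡ-≤-nonNeg (injections n k)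
           {{nonNegative (injections≥0 n k)}} (+≤+ n≤2[n∸k])) ⟩
    + (2 ^ k) * (injections n k * + (2 ℕ.* (n ∸ k)))
      ≡⟨ cong (λ d → + (2 ^ k) * (injections n k * d)) (trans (pos-* 2 (n ∸ k)) (cong (+ 2 *_) (sym (pos-∸ k≤n)))) ⟩
    + (2 ^ k) * (injections n k * (+ 2 * (+ n - + k)))
      ≡⟨ regroup (+ (2 ^ k)) (injections n k) (+ 2) (+ n - + k) ⟩
    + 2 * + (2 ^ k) * (injections n k * (+ n - + k))
      ≡⟨ cong₂ _*_ (pos-* 2 (2 ^ k)) (injections-suc n k) ⟨
    + (2 ^ suc k) * injections n (suc k) ∎
    where
    open ≤-Reasoning
    rotate : ∀ x y z → x * (y * z) ≡ y * (z * x)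
    rotate = solve-∀
    regroup : ∀ x y z w → x * (y * (z * w)) ≡ z * x * (y * w)
    regroup = solve-∀
    2k≤n' : 2 ℕ.* k ℕ.≤ n
    2k≤n' = ℕ.≤-trans (ℕ.*-monoʳ-≤ 2 (ℕ.n≤1+n k)) 2k≤n
    k≤n : k ℕ.≤ n
    k≤n = ℕ.≤-trans (ℕ.m≤m+n k (k ℕ.+ 0)) 2k≤n'
    n≤2[n∸k] : n ℕ.≤ 2 ℕ.* (n ∸ k)
    n≤2[n∸k] = subst (ℕ._≤ 2 ℕ.* (n ∸ k)) (ℕ.m∸n+n≡m k≤n) (ℕ.+-monoʳ-≤ (n ∸ k)
      (ℕ.≤-trans (ℕ.m+n≤o⇒m≤o∸n k (subst (λ m → k ℕ.+ m ℕ.≤ n) (ℕ.+-identityʳ k) 2k≤n'))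
                 (ℕ.≤-reflexive (sym (ℕ.+-identityʳ (n ∸ k))))))

  ^≤incSeqs : (n k : ℕ) → 2 ℕ.* k ℕ.≤ n → + (n ^ k) ≤ + (2 ^ k ℕ.* k !) * + length (incSeqs n k)
  ^≤incSeqs n k 2k≤n = begin
    + (n ^ k)                                       ≤⟨ ^≤injections n k 2k≤n ⟩
    + (2 ^ k) * injections n k                      ≡⟨ cong (+ (2 ^ k) *_) (k!*incSeqs n k) ⟨
    + (2 ^ k) * (+ (k !) * + length (incSeqs n k))  ≡⟨ *-assoc (+ (2 ^ k)) _ _ ⟨
    + (2 ^ k) * + (k !) * + length (incSeqs n k)    ≡⟨ cong (_* + length (incSeqs n k)) (pos-* (2 ^ k) (k !)) ⟨
    + (2 ^ k ℕ.* k !) * + length (incSeqs n k)      ∎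
    where open ≤-Reasoning

  -- Upper bounds may pass to arbitrary functions, whose coordinates can be resampled one at a time;
  -- monotonicity would tie them together.
  ∑-incSeqs≤ : (n k : ℕ) (f : (Fin k → Fin n) → ℤ) → (∀ y → 0ℤ ≤ f y) →
               ∑ (incSeqs n k) f ≤ ∑ (allFuns k (allFin n)) f
  ∑-incSeqs≤ n k f f≥0 = begin
    ∑ (incSeqs n k) f
      ≡⟨ ∑-filter strictInc? (allFuns k (allFin n)) f ⟩
    (∑[ y ∈ allFuns k (allFin n) ] (χ (strictInc? y) * f y))
      ≤⟨ ∑-mono (allFuns k (allFin n)) (λ y → *-monoʳ-≤-nonNeg (f y) {{nonNegative (f≥0 y)}} (χ≤1 (strictInc? y))) ⟩
    (∑[ y ∈ allFuns k (allFin n) ] (1ℤ * f y))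
      ≡⟨ ∑-cong (allFuns k (allFin n)) (λ y → *-identityˡ (f y)) ⟩
    ∑ (allFuns k (allFin n)) f ∎
    where open ≤-Reasoning

  length-incSeqs≤ : (n k : ℕ) → + length (incSeqs n k) ≤ + (n ^ k)
  length-incSeqs≤ n k = begin
    + length (incSeqs n k)                  ≡⟨ length≡∑ (incSeqs n k) ⟩
    (∑[ _ ∈ incSeqs n k ] 1ℤ)               ≤⟨ ∑-incSeqs≤ n k (λ _ → 1ℤ) (λ _ → +≤+ ℕ.z≤n) ⟩
    (∑[ _ ∈ allFuns k (allFin n) ] 1ℤ)      ≡⟨ ∑-allFuns-const k (allFin n) 1ℤ ⟩
    + (length (allFin n) ^ k) * 1ℤ          ≡⟨ *-identityʳ _ ⟩
    + (length (allFin n) ^ k)               ≡⟨ cong (λ l → + (l ^ k)) (length-tabulate {n = n} id) ⟩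
    + (n ^ k)                               ∎
    where open ≤-Reasoning

-- Latin squares: symmetry in the symbols, and existence

module Latin where

  open import Data.Nat.Base as ℕ using (ℕ; suc; _∸_; _%_)
  import Data.Nat.Properties as ℕ
  import Data.Nat.DivMod as DivMod
  open import Data.Integer using (ℤ; 1ℤ; +_; _*_)
  open import Data.Integer.Properties using (*-identityʳ; +-injective)
  open import Data.Fin.Base using (Fin; toℕ; fromℕ<)
  open import Data.Fin.Properties using (_≟_; toℕ-fromℕ<; toℕ-injective; toℕ<n)
  open import Data.Fin.Permutation.Components using (transpose)
  open import Data.List.Base using (length; allFin)
  open import Data.List.Properties using (filter-some)
  open import Data.List.Membership.Propositional.Properties using (∈-allFin)
  open import Data.List.Relation.Unary.Any as Any using (Any)
  open import Data.Product.Base using (_×_; _,_; uncurry)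
  open import Function.Base using (_∘_; id)
  open import Level using (0ℓ)
  open import Relation.Unary using (Pred; Decidable)
  open import Relation.Binary.PropositionalEquality

  open Sums
  open Words
  open Exchange
  open Functions

  private variable
    m n : ℕ

  count≡∑ : {P : Pred (Fin m) 0ℓ} (P? : Decidable P) → + count P? ≡ ∑ (allFin m) (χ ∘ P?)
  count≡∑ {m} P? = length-filter≡∑ P? (allFin m)

  count-cong : {P Q : Pred (Fin m) 0ℓ} (P? : Decidable P) (Q? : Decidable Q) →
               (∀ i → P i → Q i) → (∀ i → Q i → P i) → count P? ≡ count Q?
  count-cong {m} P? Q? f g = +-injective (trans (count≡∑ P?) (trans
    (∑-cong (allFin m) (λ i → χ-⇔ (P? i) (Q? i) (f i) (g i))) (sym (count≡∑ Q?))))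

  -- The two conditions say that `v` occupies in `L'` exactly the cells that `π v` occupies in `L`,
  -- so the counts agree. This covers pointwise equality, with `π = id`, as well as a swap of
  -- symbols and its reversal.
  IsLatin-relabel : (L L' : Matrix (Fin n) n n) (π : Fin n → Fin n) →
    (∀ i j v → L' i j ≡ v → L i j ≡ π v) → (∀ i j v → L i j ≡ π v → L' i j ≡ v) →
    IsLatin n L → IsLatin n L'
  IsLatin-relabel L L' π f g (rows , cols) =
      (λ i v → trans (count-cong (λ j → L' i j ≟ v) (λ j → L i j ≟ π v) (λ j → f i j v) (λ j → g i j v))
                     (rows i (π v)))
    , (λ j v → trans (count-cong (λ i → L' i j ≟ v) (λ i → L i j ≟ π v) (λ i → f i j v) (λ i → g i j v))
                     (cols j (π v)))

  IsLatin-ext : (L L' : Matrix (Fin n) n n) → (∀ i j → L i j ≡ L' i j) → IsLatin n L → IsLatin n L'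
  IsLatin-ext L L' eq = IsLatin-relabel L L' id (λ i j v e → trans (eq i j) e) (λ i j v e → trans (sym (eq i j)) e)

  IsLatin-transpose⁺ : (a b : Fin n) (L : Matrix (Fin n) n n) →
    IsLatin n L → IsLatin n (λ i j → transpose a b (L i j))
  IsLatin-transpose⁺ a b L = IsLatin-relabel L _ (transpose a b)
    (λ i j v → transpose-adjoint a b (L i j) v)
    (λ i j v e → trans (cong (transpose a b) e) (transpose-involutive a b v))

  IsLatin-transpose⁻ : (a b : Fin n) (L : Matrix (Fin n) n n) →
    IsLatin n (λ i j → transpose a b (L i j)) → IsLatin n L
  IsLatin-transpose⁻ a b L = IsLatin-relabel (λ i j → transpose a b (L i j)) L (transpose a b)
    (λ i j v → cong (transpose a b))
    (λ i j v e → trans (transpose-adjoint a b (L i j) _ e) (transpose-involutive a b v))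

  entry : Matrix (Fin n) n n → Fin n × Fin n → Fin n
  entry L = uncurry L

  -- A swap of symbols permutes the values, hence the possible rows, hence all square matrices; it
  -- preserves and reflects being Latin, so the sum restricted to Latin squares is invariant too.
  latin-relabelInvariant : (n : ℕ) → RelabelInvariant (latinSquares n) entry
  latin-relabelInvariant n a b F F-ext = begin
    (∑[ L ∈ latinSquares n ] F (τ ∘ entry L))
      ≡⟨ ∑-filter (isLatin? n) (allSquares n) (λ L → F (τ ∘ entry L)) ⟩
    (∑[ L ∈ allSquares n ] (χ (isLatin? n L) * F (τ ∘ entry L)))
      ≡⟨ ∑-cong (allSquares n) (λ L → cong (_* F (τ ∘ entry L))
           (χ-⇔ (isLatin? n L) (isLatin? n ((τ ∘_) ∘ L)) (IsLatin-transpose⁺ a b L) (IsLatin-transpose⁻ a b L))) ⟩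
    (∑[ L ∈ allSquares n ] f ((τ ∘_) ∘ L))
      ≡⟨ allFuns-invariant n (λ _ → refl) (allFuns-invariant n refl (transpose-invariant a b)) f
           (λ {L} {L'} eq → cong₂ _*_
             (χ-⇔ (isLatin? n L) (isLatin? n L') (IsLatin-ext L L' eq) (IsLatin-ext L' L (λ i j → sym (eq i j))))
             (F-ext (λ (i , j) → eq i j))) ⟩
    (∑[ L ∈ allSquares n ] f L)
      ≡⟨ ∑-filter (isLatin? n) (allSquares n) (F ∘ entry) ⟨
    (∑[ L ∈ latinSquares n ] F (entry L)) ∎
    where
    open ≡-Reasoning
    τ = transpose a b
    f : Matrix (Fin n) n n → ℤ
    f L = χ (isLatin? n L) * F (entry L)

  -- The addition table of the integers modulo `suc m`.
  cyclic : (m : ℕ) → Matrix (Fin (suc m)) (suc m) (suc m)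
  cyclic m i j = fromℕ< (DivMod.m%n<n (toℕ i ℕ.+ toℕ j) (suc m))

  -- Subtraction of `i` modulo `suc m`, with `suc m ∸ toℕ i` as a nonnegative representative of the
  -- negative of `i`.
  cyclic⁻¹ : (m : ℕ) → Matrix (Fin (suc m)) (suc m) (suc m)
  cyclic⁻¹ m i v = fromℕ< (DivMod.m%n<n (toℕ v ℕ.+ (suc m ∸ toℕ i)) (suc m))

  cyclic-comm : (m : ℕ) (i j : Fin (suc m)) → cyclic m i j ≡ cyclic m j i
  cyclic-comm m i j = toℕ-injective (trans (toℕ-fromℕ< _)
    (trans (cong (_% suc m) (ℕ.+-comm (toℕ i) (toℕ j))) (sym (toℕ-fromℕ< _))))

  %-absorbʳ : (a b d : ℕ) .{{_ : ℕ.NonZero d}} → (a ℕ.+ b % d) % d ≡ (a ℕ.+ b) % d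
  %-absorbʳ a b d = trans (DivMod.%-distribˡ-+ a (b % d) d)
    (trans (cong (λ r → (a % d ℕ.+ r) % d) (DivMod.m%n%n≡m%n b d)) (sym (DivMod.%-distribˡ-+ a b d)))

  module _ (m : ℕ) (i : Fin (suc m)) where
    private
      N = suc m
      reduce : ∀ s (v : Fin N) → s ≡ toℕ v ℕ.+ N → s % N ≡ toℕ v
      reduce s v eq = trans (cong (_% N) eq) (trans (DivMod.[m+n]%n≡m%n (toℕ v) N) (DivMod.m<n⇒m%n≡m (toℕ<n v)))

      i+[N∸i]≡N : toℕ i ℕ.+ (N ∸ toℕ i) ≡ N
      i+[N∸i]≡N = ℕ.m+[n∸m]≡n (ℕ.<⇒≤ (toℕ<n i))

    cyclic-cyclic⁻¹ : ∀ v → cyclic m i (cyclic⁻¹ m i v) ≡ v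
    cyclic-cyclic⁻¹ v = toℕ-injective (begin
      toℕ (cyclic m i (cyclic⁻¹ m i v))
        ≡⟨ trans (toℕ-fromℕ< _) (cong (λ r → (toℕ i ℕ.+ r) % N) (toℕ-fromℕ< _)) ⟩
      (toℕ i ℕ.+ (toℕ v ℕ.+ (N ∸ toℕ i)) % N) % N
        ≡⟨ %-absorbʳ (toℕ i) (toℕ v ℕ.+ (N ∸ toℕ i)) N ⟩
      (toℕ i ℕ.+ (toℕ v ℕ.+ (N ∸ toℕ i))) % N
        ≡⟨ reduce _ v (begin
             toℕ i ℕ.+ (toℕ v ℕ.+ (N ∸ toℕ i)) ≡⟨ ℕ.+-assoc (toℕ i) (toℕ v) _ ⟨
             toℕ i ℕ.+ toℕ v ℕ.+ (N ∸ toℕ i)   ≡⟨ cong (ℕ._+ (N ∸ toℕ i)) (ℕ.+-comm (toℕ i) (toℕ v)) ⟩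
             toℕ v ℕ.+ toℕ i ℕ.+ (N ∸ toℕ i)   ≡⟨ ℕ.+-assoc (toℕ v) (toℕ i) _ ⟩
             toℕ v ℕ.+ (toℕ i ℕ.+ (N ∸ toℕ i)) ≡⟨ cong (toℕ v ℕ.+_) i+[N∸i]≡N ⟩
             toℕ v ℕ.+ N                       ∎) ⟩
      toℕ v ∎)
      where open ≡-Reasoning

    cyclic⁻¹-cyclic : ∀ j → cyclic⁻¹ m i (cyclic m i j) ≡ j
    cyclic⁻¹-cyclic j = toℕ-injective (begin
      toℕ (cyclic⁻¹ m i (cyclic m i j))
        ≡⟨ trans (toℕ-fromℕ< _) (cong (λ r → (r ℕ.+ (N ∸ toℕ i)) % N)
             (toℕ-fromℕ< (DivMod.m%n<n (toℕ i ℕ.+ toℕ j) N))) ⟩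
      ((toℕ i ℕ.+ toℕ j) % N ℕ.+ (N ∸ toℕ i)) % N
        ≡⟨ cong (_% N) (ℕ.+-comm ((toℕ i ℕ.+ toℕ j) % N) (N ∸ toℕ i)) ⟩
      ((N ∸ toℕ i) ℕ.+ (toℕ i ℕ.+ toℕ j) % N) % N
        ≡⟨ %-absorbʳ (N ∸ toℕ i) (toℕ i ℕ.+ toℕ j) N ⟩
      ((N ∸ toℕ i) ℕ.+ (toℕ i ℕ.+ toℕ j)) % N
        ≡⟨ reduce _ j (begin
             (N ∸ toℕ i) ℕ.+ (toℕ i ℕ.+ toℕ j) ≡⟨ ℕ.+-assoc (N ∸ toℕ i) (toℕ i) (toℕ j) ⟨
             (N ∸ toℕ i) ℕ.+ toℕ i ℕ.+ toℕ j   ≡⟨ cong (ℕ._+ toℕ j) (trans (ℕ.+-comm (N ∸ toℕ i) (toℕ i)) i+[N∸i]≡N) ⟩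
             N ℕ.+ toℕ j                       ≡⟨ ℕ.+-comm N (toℕ j) ⟩
             toℕ j ℕ.+ N                       ∎) ⟩
      toℕ j ∎)
      where open ≡-Reasoning

    count-cyclic : ∀ v → count (λ j → cyclic m i j ≟ v) ≡ 1
    count-cyclic v = +-injective (begin
      + count (λ j → cyclic m i j ≟ v)
        ≡⟨ count≡∑ (λ j → cyclic m i j ≟ v) ⟩
      (∑[ j ∈ allFin N ] χ (cyclic m i j ≟ v))
        ≡⟨ ∑-inverse (cyclic m i) (cyclic⁻¹ m i) cyclic-cyclic⁻¹ cyclic⁻¹-cyclic (λ j → χ (j ≟ v)) ⟩
      (∑[ j ∈ allFin N ] χ (j ≟ v))
        ≡⟨ ∑-cong (allFin N) (λ j → trans (χ-⇔ (j ≟ v) (v ≟ j) sym sym) (sym (*-identityʳ _))) ⟩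
      (∑[ j ∈ allFin N ] (χ (v ≟ j) * 1ℤ))
        ≡⟨ ∑-δ v (λ _ → 1ℤ) ⟩
      1ℤ ∎)
      where open ≡-Reasoning

  IsLatin-cyclic : (m : ℕ) → IsLatin (suc m) (cyclic m)
  IsLatin-cyclic m = count-cyclic m , λ j v → trans
    (count-cong (λ i → cyclic m i j ≟ v) (λ i → cyclic m j i ≟ v)
      (λ i e → trans (cyclic-comm m j i) e) (λ i e → trans (cyclic-comm m i j) e))
    (count-cyclic m j v)

  -- By the convention `a ÷ zero = 0ℚ`, an order without Latin squares would have `proportion` 0
  -- instead of a value near 1. The cyclic square occurs in the list up to pointwise equality, which
  -- `IsLatin-ext` absorbs.
  latinSquares-nonempty : (m : ℕ) → 0 ℕ.< length (latinSquares (suc m))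
  latinSquares-nonempty m = filter-some (isLatin? (suc m)) (Any.map
    (λ {L} eq → IsLatin-ext (cyclic m) L (λ i j → sym (eq i j)) (IsLatin-cyclic m))
    (allFuns-complete {_≈_ = _≗_} (allFuns (suc m) (allFin (suc m))) (cyclic m)
      (λ i → allFuns-complete {_≈_ = _≡_} (allFin (suc m)) (cyclic m i)
        (λ j → Any.map sym (∈-allFin (cyclic m i j))))))

-- Order equivalence with the pattern as monotonicity of a word

module Orders where

  open import Data.Nat.Base as ℕ using (ℕ)
  import Data.Nat.Properties as ℕ
  open import Data.Integer using (0ℤ; 1ℤ; +_; _+_; _*_; _≤_; drop‿+≤+)
  open import Data.Integer.Properties
    using (*-identityʳ; *-comm; +-injective; ≤-reflexive; module ≤-Reasoning)
  open import Data.Fin.Base using (Fin; _<_)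
  open import Data.Fin.Properties as Fin using (_≟_; _<?_; any?)
  open import Data.List.Base using (List; []; _∷_; length; allFin; cartesianProduct; map; filter)
  open import Data.List.Membership.Propositional using (_∈_)
  open import Data.List.Membership.Propositional.Properties
    using (∈-allFin; ∈-cartesianProduct⁺; ∈-filter⁺; ∈-filter⁻)
  open import Data.List.Relation.Unary.Any using (here)
  open import Data.Product.Base using (Σ; ∃; _×_; _,_; proj₁; proj₂; uncurry)
  open import Function.Base using (_∘_)
  open import Relation.Nullary using (Dec; yes; no; ¬_; contradiction)
  open import Relation.Nullary.Decidable using (_×-dec_)
  open import Relation.Binary.Definitions using (tri<; tri≈; tri>)
  open import Relation.Binary.PropositionalEquality

  open Sums
  open Words
  open Functions
  open Latin

  private variable
    B : Set
    k ℓ m n : ℕ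

  singleton : (xs : List B) → length xs ≡ 1 → Σ B λ x → x ∈ xs × (∀ {y} → y ∈ xs → y ≡ x)
  singleton (x ∷ []) _ = x , here refl , λ { (here y≡x) → y≡x }

  -- The inverse of `A` as a bijection from cells to values. Running through `position r` by
  -- increasing `r` visits the cells in the order of their entries in `A`.
  record Positions {k ℓ m : ℕ} (A : Matrix (Fin m) k ℓ) : Set where
    field
      position : Fin m → Fin k × Fin ℓ
      A-position : ∀ r → uncurry A (position r) ≡ r
      position-A : ∀ i j → position (A i j) ≡ (i , j)

    position-injective : ∀ {r s} → position r ≡ position s → r ≡ s
    position-injective {r} {s} eq = trans (sym (A-position r)) (trans (cong (uncurry A) eq) (A-position s))

  InR⇒Positions : (A : Matrix (Fin (k ℕ.* ℓ)) k ℓ) → InR k ℓ A → Positions A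
  InR⇒Positions {k} {ℓ} A A∈R = record
    { position   = λ r → proj₁ (cell r)
    ; A-position = λ r → proj₂ (∈-filter⁻ (A≟ r) {xs = cells} (proj₁ (proj₂ (cell r))))
    ; position-A = λ i j → sym (proj₂ (proj₂ (cell (A i j)))
        (∈-filter⁺ (A≟ (A i j)) (∈-cartesianProduct⁺ (∈-allFin i) (∈-allFin j)) refl))
    }
    where
    cells = cartesianProduct (allFin k) (allFin ℓ)
    A≟ : ∀ r (p : Fin k × Fin ℓ) → Dec (A (proj₁ p) (proj₂ p) ≡ r)
    A≟ r p = A (proj₁ p) (proj₂ p) ≟ r
    cell : ∀ r → Σ (Fin k × Fin ℓ) λ p → p ∈ filter (A≟ r) cells × (∀ {q} → q ∈ filter (A≟ r) cells → q ≡ p)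
    cell r = singleton (filter (A≟ r) cells) (A∈R r)

  below? : (M : Matrix (Fin n) k ℓ) (x v : Fin n) → Dec (v < x × (∃ λ i → ∃ λ j → M i j ≡ v))
  below? M x v = (v <? x) ×-dec any? (λ i → any? (λ j → M i j ≟ v))

  rank≡∑-below : (M : Matrix (Fin n) k ℓ) (x : Fin n) → + rank M x ≡ (∑[ v ∈ allFin n ] χ (below? M x v))
  rank≡∑-below M x = count≡∑ (below? M x)

  rank-mono : (M : Matrix (Fin n) k ℓ) {x y : Fin n} → ¬ y < x → rank M x ℕ.≤ rank M y
  rank-mono {n} M {x} {y} y≮x = drop‿+≤+ (begin
    + rank M x
      ≡⟨ rank≡∑-below M x ⟩
    (∑[ v ∈ allFin n ] χ (below? M x v))
      ≤⟨ ∑-mono (allFin n) (λ v → χ-mono (below? M x v) (below? M y v)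
           (λ (v<x , occurs) → ℕ.<-≤-trans v<x (ℕ.≮⇒≥ y≮x) , occurs)) ⟩
    (∑[ v ∈ allFin n ] χ (below? M y v))
      ≡⟨ rank≡∑-below M y ⟨
    + rank M y ∎)
    where open ≤-Reasoning

  module _ {A : Matrix (Fin m) k ℓ} (pos : Positions A) where
    open Positions pos

    -- `rank` counts distinct values; when the entries are distinct, every value that occurs belongs
    -- to exactly one cell, so cells may be counted instead.
    rank≡∑ : (M : Matrix (Fin n) k ℓ) → (∀ {s t} → uncurry M (position s) ≡ uncurry M (position t) → s ≡ t) →
             ∀ x → + rank M x ≡ (∑[ s ∈ allFin m ] χ (uncurry M (position s) <? x))
    rank≡∑ {n} M M-inj x = begin
      + rank M x
        ≡⟨ rank≡∑-below M x ⟩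
      (∑[ v ∈ allFin n ] χ (below? M x v))
        ≡⟨ ∑-cong (allFin n) (λ v → trans (χ-× (v <? x) _) (cong (χ (v <? x) *_) (occurs v))) ⟩
      (∑[ v ∈ allFin n ] (χ (v <? x) * (∑[ s ∈ allFin m ] χ (uncurry M (position s) ≟ v))))
        ≡⟨ ∑-cong (allFin n) (λ v → ∑-*ˡ (allFin m) (χ (v <? x)) _) ⟨
      (∑[ v ∈ allFin n ] ∑[ s ∈ allFin m ] (χ (v <? x) * χ (uncurry M (position s) ≟ v)))
        ≡⟨ ∑-swap (allFin n) (allFin m) _ ⟩
      (∑[ s ∈ allFin m ] ∑[ v ∈ allFin n ] (χ (v <? x) * χ (uncurry M (position s) ≟ v)))
        ≡⟨ ∑-cong (allFin m) (λ s → trans (∑-cong (allFin n) (λ v → *-comm (χ (v <? x)) _))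
             (∑-δ (uncurry M (position s)) (λ v → χ (v <? x)))) ⟩
      (∑[ s ∈ allFin m ] χ (uncurry M (position s) <? x)) ∎
      where
      open ≡-Reasoning
      occurs : ∀ v → χ (any? (λ i → any? (λ j → M i j ≟ v))) ≡ (∑[ s ∈ allFin m ] χ (uncurry M (position s) ≟ v))
      occurs v with any? (λ i → any? (λ j → M i j ≟ v))
      ... | yes (i , j , Mij≡v) = trans (χ-yes (yes (i , j , Mij≡v)) (i , j , Mij≡v)) (sym (trans
              (∑-cong (allFin m) (λ s → trans
                (χ-⇔ (uncurry M (position s) ≟ v) (A i j ≟ s)
                  (λ e → M-inj (trans (cong (uncurry M) (position-A i j)) (trans Mij≡v (sym e))))
                  (λ { refl → trans (cong (uncurry M) (position-A i j)) Mij≡v }))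
                (sym (*-identityʳ _))))
              (∑-δ (A i j) (λ _ → 1ℤ))))
      ... | no ∄ = trans (χ-no (no ∄) ∄) (sym (trans
              (∑-cong (allFin m) (λ s → χ-no (uncurry M (position s) ≟ v) (λ e → ∄ (_ , _ , e))))
              (∑-zero (allFin m))))

    rank-A : ∀ r → + rank A r ≡ (∑[ s ∈ allFin m ] χ (s <? r))
    rank-A r = trans (rank≡∑ A (λ {s} {t} e → trans (sym (A-position s)) (trans e (A-position t))) r)
      (∑-cong (allFin m) (λ s → cong (λ c → χ (c <? r)) (A-position s)))

    -- Every value occurs in `A`, so `r` itself is counted below `s` but not below `r`.
    rank-A-strictMono : ∀ {r s} → r < s → rank A r ℕ.< rank A s
    rank-A-strictMono {r} {s} r<s = drop‿+≤+ (begin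
      1ℤ + + rank A r
        ≡⟨ cong₂ _+_ (sym (∑-δ r (λ _ → 1ℤ))) (rank-A r) ⟩
      (∑[ t ∈ allFin m ] (χ (r ≟ t) * 1ℤ)) + (∑[ t ∈ allFin m ] χ (t <? r))
        ≡⟨ ∑-+ (allFin m) _ _ ⟨
      (∑[ t ∈ allFin m ] (χ (r ≟ t) * 1ℤ + χ (t <? r)))
        ≤⟨ ∑-mono (allFin m) bound ⟩
      (∑[ t ∈ allFin m ] χ (t <? s))
        ≡⟨ rank-A s ⟨
      + rank A s ∎)
      where
      open ≤-Reasoning
      bound : ∀ t → χ (r ≟ t) * 1ℤ + χ (t <? r) ≤ χ (t <? s)
      bound t with Fin.<-cmp t r
      ... | tri< t<r t≢r _ = ≤-reflexive (trans
              (cong₂ _+_ (trans (*-identityʳ _) (χ-no (r ≟ t) (t≢r ∘ sym))) (χ-yes (t <? r) t<r))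
              (sym (χ-yes (t <? s) (Fin.<-trans t<r r<s))))
      ... | tri≈ t≮r refl _ = ≤-reflexive (trans
              (cong₂ _+_ (trans (*-identityʳ _) (χ-yes (t ≟ t) refl)) (χ-no (t <? t) t≮r))
              (sym (χ-yes (t <? s) r<s)))
      ... | tri> t≮r t≢r _ = begin
              χ (r ≟ t) * 1ℤ + χ (t <? r)
                ≡⟨ cong₂ _+_ (trans (*-identityʳ _) (χ-no (r ≟ t) (t≢r ∘ sym))) (χ-no (t <? r) t≮r) ⟩
              0ℤ
                ≤⟨ χ≥0 (t <? s) ⟩
              χ (t <? s) ∎

    -- Reduces every pattern to the increasing one by reading the cells in the order of `A`. The
    -- ranks in `A` increase strictly along this order and `rank M` is monotone, so equivalence
    -- forces the entries of `M` to increase strictly, hence to be distinct. Conversely, an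
    -- increasing word makes the comparisons in `M` and in `A` agree cell by cell.
    ordEquiv-inc : (M : Matrix (Fin n) k ℓ) → χ (ordEquiv? A M) ≡ inc (map (uncurry M ∘ position) (allFin m))
    ordEquiv-inc M = trans (χ-⇔ (ordEquiv? A M) (strictInc? (uncurry M ∘ position)) to from)
                           (strictInc-inc (uncurry M ∘ position))
      where
      to : OrdEquiv A M → StrictInc (uncurry M ∘ position)
      to A≡M r s r<s with uncurry M (position r) <? uncurry M (position s)
      ... | yes M< = M<
      ... | no ¬M< = contradiction (rank-A-strictMono r<s) (ℕ.≤⇒≯ (begin
              rank A s                         ≡⟨ same s ⟩
              rank M (uncurry M (position s))  ≤⟨ rank-mono M ¬M< ⟩
              rank M (uncurry M (position r))  ≡⟨ same r ⟨
              rank A r                         ∎))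
        where
        open ℕ.≤-Reasoning
        same : ∀ r → rank A r ≡ rank M (uncurry M (position r))
        same r = trans (cong (rank A) (sym (A-position r))) (A≡M _ _)
      from : StrictInc (uncurry M ∘ position) → OrdEquiv A M
      from M< i j = +-injective (begin
        + rank A (A i j)
          ≡⟨ rank-A (A i j) ⟩
        (∑[ s ∈ allFin m ] χ (s <? A i j))
          ≡⟨ ∑-cong (allFin m) (λ s → χ-⇔ (s <? A i j) (uncurry M (position s) <? M i j) (forth s) (back s)) ⟩
        (∑[ s ∈ allFin m ] χ (uncurry M (position s) <? M i j))
          ≡⟨ rank≡∑ M M-inj (M i j) ⟨
        + rank M (M i j) ∎)
        where
        open ≡-Reasoning
        Mij : uncurry M (position (A i j)) ≡ M i j
        Mij = cong (uncurry M) (position-A i j)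
        M-inj : ∀ {s t} → uncurry M (position s) ≡ uncurry M (position t) → s ≡ t
        M-inj {s} {t} e with Fin.<-cmp s t
        ... | tri< s<t _ _ = contradiction (M< s t s<t) (Fin.<-irrefl e)
        ... | tri≈ _ s≡t _ = s≡t
        ... | tri> _ _ t<s = contradiction (M< t s t<s) (Fin.<-irrefl (sym e))
        forth : ∀ s → s < A i j → uncurry M (position s) < M i j
        forth s s< = subst (uncurry M (position s) <_) Mij (M< s (A i j) s<)
        back : ∀ s → uncurry M (position s) < M i j → s < A i j
        back s Ms< with Fin.<-cmp s (A i j)
        ... | tri< s< _ _  = s<
        ... | tri≈ _ s≡ _  = contradiction Ms< (Fin.<-irrefl (trans (cong (uncurry M ∘ position) s≡) Mij))
        ... | tri> _ _ s>  = contradiction Ms< (Fin.<-asym (subst (_< uncurry M (position s)) Mij (M< (A i j) s s>)))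

-- Coincidences among the entries read by placements

module Collisions where

  open import Data.Nat.Base as ℕ using (ℕ; suc; _^_)
  import Data.Nat.Properties as ℕ
  open import Data.Integer using (ℤ; 0ℤ; 1ℤ; +_; _+_; _*_; _-_; _≤_; +≤+; nonNegative)
  open import Data.Integer.Properties
    using (*-identityʳ; *-zeroʳ; *-comm; *-assoc; *-distribˡ-+; +-identityˡ; +-identityʳ; ≤-refl;
           ≤-reflexive; ≤-trans; +-mono-≤; +-monoˡ-≤; +-monoʳ-≤; *-monoˡ-≤-nonNeg;
           *-monoʳ-≤-nonNeg; pos-*; module ≤-Reasoning)
  open import Data.Integer.Tactic.RingSolver using (solve-∀)
  open import Data.Fin.Base using (Fin)
  open import Data.Fin.Properties using (_≟_)
  open import Data.List.Base using (List; []; _∷_; _++_; length; allFin; cartesianProduct; map)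
  open import Data.List.Properties using (length-tabulate)
  open import Data.List.Relation.Unary.All as All using (All; []; _∷_)
  open import Data.List.Relation.Unary.AllPairs using ([]; _∷_)
  open import Data.List.Relation.Unary.Unique.Propositional using (Unique)
  open import Data.List.Relation.Unary.Unique.DecPropositional using (unique?)
  open import Data.Product.Base using (_×_; _,_; proj₁; proj₂)
  open import Data.Vec.Functional using (updateAt)
  open import Data.Vec.Functional.Properties using (updateAt-updates; updateAt-minimal)
  open import Function.Base using (_∘_; id)
  open import Relation.Nullary using (Dec; yes; no; ¬_; contradiction)
  open import Relation.Binary.PropositionalEquality

  open Sums
  open Words
  open Functions
  open Latin

  private variable
    A B : Set
    k ℓ n : ℕ

  ∑≤length* : (xs : List A) {f : A → ℤ} {c : ℤ} → (∀ x → f x ≤ c) → ∑ xs f ≤ + length xs * c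
  ∑≤length* xs f≤c = ≤-trans (∑-mono xs f≤c) (≤-reflexive (∑-const xs _))

  -- The number of pairs of positions that carry the same letter. Unlike the indicator of a
  -- repetition, it is a sum over pairs, so each pair can be estimated separately.
  coll : List (Fin n) → ℤ
  coll []      = 0ℤ
  coll (a ∷ u) = (∑[ b ∈ u ] χ (a ≟ b)) + coll u

  cross : List (Fin n) → List (Fin n) → ℤ
  cross u v = ∑[ a ∈ u ] ∑[ b ∈ v ] χ (a ≟ b)

  coll≥0 : (u : List (Fin n)) → 0ℤ ≤ coll u
  coll≥0 []      = ≤-refl
  coll≥0 (a ∷ u) = +-mono-≤ (∑-nonneg u (λ b → χ≥0 (a ≟ b))) (coll≥0 u)

  coll-++ : (u v : List (Fin n)) → coll (u ++ v) ≡ coll u + cross u v + coll v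
  coll-++ []      v = sym (+-identityˡ _)
  coll-++ (a ∷ u) v = trans
    (cong₂ _+_ (∑-++ u v (λ b → χ (a ≟ b))) (coll-++ u v))
    (rearrange (∑[ b ∈ u ] χ (a ≟ b)) (∑[ b ∈ v ] χ (a ≟ b)) (coll u) (cross u v) (coll v))
    where
    rearrange : ∀ p q r s t → (p + q) + (r + s + t) ≡ (p + r) + (q + s) + t
    rearrange = solve-∀

  fresh-or-equal : (a : Fin n) (u : List (Fin n)) → 1ℤ ≤ χ (fresh? a u) + (∑[ b ∈ u ] χ (a ≟ b))
  fresh-or-equal a []      = ≤-reflexive (sym (cong (_+ 0ℤ) (χ-yes (fresh? a []) [])))
  fresh-or-equal a (b ∷ u) = go (a ≟ b)
    where
    open ≤-Reasoning
    go : Dec (a ≡ b) → 1ℤ ≤ χ (fresh? a (b ∷ u)) + (χ (a ≟ b) + (∑[ b ∈ u ] χ (a ≟ b)))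
    go (yes a≡b) = +-mono-≤ (χ≥0 (fresh? a (b ∷ u)))
      (+-mono-≤ (≤-reflexive (sym (χ-yes (a ≟ b) a≡b))) (∑-nonneg u (λ b → χ≥0 (a ≟ b))))
    go (no a≢b)  = begin
      1ℤ
        ≤⟨ fresh-or-equal a u ⟩
      χ (fresh? a u) + (∑[ b ∈ u ] χ (a ≟ b))
        ≡⟨ cong₂ _+_
             (χ-⇔ (fresh? a u) (fresh? a (b ∷ u)) (a≢b ∷_) (λ { (_ ∷ a≢u) → a≢u }))
             (sym (trans (cong (_+ (∑[ b ∈ u ] χ (a ≟ b))) (χ-no (a ≟ b) a≢b)) (+-identityˡ _))) ⟩
      χ (fresh? a (b ∷ u)) + (χ (a ≟ b) + (∑[ b ∈ u ] χ (a ≟ b))) ∎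

  -- The union bound: a word with a repetition has at least one coinciding pair.
  unique-or-coll : (u : List (Fin n)) → 1ℤ ≤ U u + coll u
  unique-or-coll []      = ≤-reflexive (sym (cong (_+ 0ℤ) (χ-yes (unique? _≟_ []) [])))
  unique-or-coll (a ∷ u) = go (unique? _≟_ u)
    where
    open ≤-Reasoning
    go : Dec (Unique u) → 1ℤ ≤ U (a ∷ u) + coll (a ∷ u)
    go (yes uniq) = begin
      1ℤ
        ≤⟨ fresh-or-equal a u ⟩
      χ (fresh? a u) + (∑[ b ∈ u ] χ (a ≟ b))
        ≡⟨ cong₂ _+_
             (χ-⇔ (fresh? a u) (unique? _≟_ (a ∷ u)) (_∷ uniq) (λ { (a≢u ∷ _) → a≢u }))
             (sym (+-identityʳ _)) ⟩
      U (a ∷ u) + ((∑[ b ∈ u ] χ (a ≟ b)) + 0ℤ)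
        ≤⟨ +-monoʳ-≤ (U (a ∷ u)) (+-monoʳ-≤ (∑[ b ∈ u ] χ (a ≟ b)) (coll≥0 u)) ⟩
      U (a ∷ u) + coll (a ∷ u) ∎
    go (no ¬uniq) = begin
      1ℤ
        ≤⟨ unique-or-coll u ⟩
      U u + coll u
        ≡⟨ cong (_+ coll u) (χ-no (unique? _≟_ u) ¬uniq) ⟩
      0ℤ + coll u
        ≤⟨ +-monoˡ-≤ (coll u) (χ≥0 (unique? _≟_ (a ∷ u))) ⟩
      U (a ∷ u) + coll u
        ≤⟨ +-monoʳ-≤ (U (a ∷ u)) (≤-trans (≤-reflexive (sym (+-identityˡ _)))
             (+-monoˡ-≤ (coll u) (∑-nonneg u (λ b → χ≥0 (a ≟ b))))) ⟩
      U (a ∷ u) + coll (a ∷ u) ∎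

  Bijective : (Fin n → Fin n) → Set
  Bijective {n} h = ∀ v → (∑[ c ∈ allFin n ] χ (h c ≟ v)) ≡ 1ℤ

  -- Once the other coordinates are fixed, the target `v y` is fixed as well, and exactly one of the
  -- `n` values of `y j` is sent to it by the bijection `h`. So only one function in `n` is a hit.
  ∑-hits : (j : Fin k) (h : Fin n → Fin n) → Bijective h → (v : (Fin k → Fin n) → Fin n) →
    (∀ {y z} → y ≗ z → v y ≡ v z) → (∀ y c → v (updateAt y j (λ _ → c)) ≡ v y) →
    + n * (∑[ y ∈ incSeqs n k ] χ (h (y j) ≟ v y)) ≤ + (n ^ k)
  ∑-hits {k} {n} j h h-bij v v-ext v-indep = begin
    + n * (∑[ y ∈ incSeqs n k ] χ (h (y j) ≟ v y))
      ≤⟨ *-monoˡ-≤-nonNeg (+ n) (∑-incSeqs≤ n k _ (λ y → χ≥0 (h (y j) ≟ v y))) ⟩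
    + n * (∑[ y ∈ allFuns k (allFin n) ] χ (h (y j) ≟ v y))
      ≡⟨ cong (λ l → + l * (∑[ y ∈ allFuns k (allFin n) ] χ (h (y j) ≟ v y))) (length-tabulate {n = n} id) ⟨
    + length (allFin n) * (∑[ y ∈ allFuns k (allFin n) ] χ (h (y j) ≟ v y))
      ≡⟨ ∑-allFuns-updateAt (allFin n) j (λ y → χ (h (y j) ≟ v y))
           (λ eq → cong₂ (λ a b → χ (h a ≟ b)) (eq j) (v-ext eq)) ⟩
    (∑[ y ∈ allFuns k (allFin n) ] ∑[ c ∈ allFin n ] χ (h (updateAt y j (λ _ → c) j) ≟ v (updateAt y j (λ _ → c))))
      ≡⟨ ∑-cong (allFuns k (allFin n)) (λ y → trans
           (∑-cong (allFin n) (λ c → cong₂ (λ a b → χ (h a ≟ b)) (updateAt-updates j y) (v-indep y c)))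
           (h-bij (v y))) ⟩
    (∑[ y ∈ allFuns k (allFin n) ] 1ℤ)
      ≡⟨ trans (∑-allFuns-const k (allFin n) 1ℤ) (*-identityʳ _) ⟩
    + (length (allFin n) ^ k)
      ≡⟨ cong (λ l → + (l ^ k)) (length-tabulate {n = n} id) ⟩
    + (n ^ k) ∎
    where open ≤-Reasoning

  Placement : ℕ → ℕ → ℕ → Set
  Placement n k ℓ = (Fin k → Fin n) × (Fin ℓ → Fin n)

  placements : (n k ℓ : ℕ) → List (Placement n k ℓ)
  placements n k ℓ = cartesianProduct (incSeqs n k) (incSeqs n ℓ)

  cell : Placement n k ℓ → Fin k × Fin ℓ → Fin n × Fin n
  cell (x , y) (i , j) = x i , y j

  read : Matrix (Fin n) n n → Placement n k ℓ → Fin k × Fin ℓ → Fin n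
  read L P p = entry L (cell P p)

  length-placements : (n k ℓ : ℕ) → + length (placements n k ℓ) ≡ + length (incSeqs n k) * + length (incSeqs n ℓ)
  length-placements n k ℓ = begin
    + length (placements n k ℓ)
      ≡⟨ length≡∑ (placements n k ℓ) ⟩
    (∑[ _ ∈ placements n k ℓ ] 1ℤ)
      ≡⟨ ∑-cartesianProduct (incSeqs n k) (incSeqs n ℓ) (λ _ → 1ℤ) ⟩
    (∑[ _ ∈ incSeqs n k ] ∑[ _ ∈ incSeqs n ℓ ] 1ℤ)
      ≡⟨ ∑-const (incSeqs n k) _ ⟩
    + length (incSeqs n k) * (∑[ _ ∈ incSeqs n ℓ ] 1ℤ)
      ≡⟨ cong (+ length (incSeqs n k) *_) (length≡∑ (incSeqs n ℓ)) ⟨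
    + length (incSeqs n k) * + length (incSeqs n ℓ) ∎
    where open ≡-Reasoning

  -- Counts pairs of arbitrary functions rather than increasing ones, the unit in which bounds by
  -- resampling come out; `all-placements≤` converts it back.
  all-placements : (n k ℓ : ℕ) → ℤ
  all-placements n k ℓ = + (n ^ k) * + (n ^ ℓ)

  length-placements≤ : (n k ℓ : ℕ) → + length (placements n k ℓ) ≤ all-placements n k ℓ
  length-placements≤ n k ℓ = begin
    + length (placements n k ℓ)
      ≡⟨ length-placements n k ℓ ⟩
    + length (incSeqs n k) * + length (incSeqs n ℓ)
      ≤⟨ *-monoʳ-≤-nonNeg (+ length (incSeqs n ℓ)) (length-incSeqs≤ n k) ⟩
    + (n ^ k) * + length (incSeqs n ℓ)
      ≤⟨ *-monoˡ-≤-nonNeg (+ (n ^ k)) (length-incSeqs≤ n ℓ) ⟩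
    all-placements n k ℓ ∎
    where open ≤-Reasoning

  module _ {n : ℕ} (L : Matrix (Fin n) n n) (L-latin : IsLatin n L) (k ℓ : ℕ) where

    private
      𝒫 = placements n k ℓ
      W = all-placements n k ℓ

      row-bijective : ∀ i → Bijective (L i)
      row-bijective i v = trans (sym (count≡∑ (λ j → L i j ≟ v))) (cong +_ (proj₁ L-latin i v))

      col-bijective : ∀ j → Bijective (λ i → L i j)
      col-bijective j v = trans (sym (count≡∑ (λ i → L i j ≟ v))) (cong +_ (proj₂ L-latin j v))

    ∑-columns≤ : (f : Placement n k ℓ → ℤ) →
      (∀ x → + n * (∑[ y ∈ incSeqs n ℓ ] f (x , y)) ≤ + (n ^ ℓ)) → + n * ∑ 𝒫 f ≤ W
    ∑-columns≤ f bound = begin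
      + n * ∑ 𝒫 f
        ≡⟨ cong (+ n *_) (∑-cartesianProduct (incSeqs n k) (incSeqs n ℓ) f) ⟩
      + n * (∑[ x ∈ incSeqs n k ] ∑[ y ∈ incSeqs n ℓ ] f (x , y))
        ≡⟨ ∑-*ˡ (incSeqs n k) (+ n) _ ⟨
      (∑[ x ∈ incSeqs n k ] (+ n * (∑[ y ∈ incSeqs n ℓ ] f (x , y))))
        ≤⟨ ∑≤length* (incSeqs n k) bound ⟩
      + length (incSeqs n k) * + (n ^ ℓ)
        ≤⟨ *-monoʳ-≤-nonNeg (+ (n ^ ℓ)) (length-incSeqs≤ n k) ⟩
      W ∎
      where open ≤-Reasoning

    ∑-rows≤ : (f : Placement n k ℓ → ℤ) →
      (∀ y → + n * (∑[ x ∈ incSeqs n k ] f (x , y)) ≤ + (n ^ k)) → + n * ∑ 𝒫 f ≤ W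
    ∑-rows≤ f bound = begin
      + n * ∑ 𝒫 f
        ≡⟨ cong (+ n *_) (trans (∑-cartesianProduct (incSeqs n k) (incSeqs n ℓ) f)
                                (∑-swap (incSeqs n k) (incSeqs n ℓ) (λ x y → f (x , y)))) ⟩
      + n * (∑[ y ∈ incSeqs n ℓ ] ∑[ x ∈ incSeqs n k ] f (x , y))
        ≡⟨ ∑-*ˡ (incSeqs n ℓ) (+ n) _ ⟨
      (∑[ y ∈ incSeqs n ℓ ] (+ n * (∑[ x ∈ incSeqs n k ] f (x , y))))
        ≤⟨ ∑≤length* (incSeqs n ℓ) bound ⟩
      + length (incSeqs n ℓ) * + (n ^ k)
        ≤⟨ *-monoʳ-≤-nonNeg (+ (n ^ k)) (length-incSeqs≤ n ℓ) ⟩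
      + (n ^ ℓ) * + (n ^ k)
        ≡⟨ *-comm (+ (n ^ ℓ)) (+ (n ^ k)) ⟩
      W ∎
      where open ≤-Reasoning

    ∑-hit-value : (p : Fin k × Fin ℓ) (v : Fin n) → + n * (∑[ P ∈ 𝒫 ] χ (read L P p ≟ v)) ≤ W
    ∑-hit-value (i , j) v = ∑-columns≤ _ (λ x →
      ∑-hits j (L (x i)) (row-bijective (x i)) (λ _ → v) (λ _ → refl) (λ _ _ → refl))

    -- Distinct cells of the pattern differ in their column index or in their row index. The
    -- differing index of `p` can be resampled while the entry at `q` stays put, and the Latin
    -- property makes the entry at `p` run bijectively through all symbols.
    ∑-hit-pair : (p q : Fin k × Fin ℓ) → p ≢ q → + n * (∑[ P ∈ 𝒫 ] χ (read L P p ≟ read L P q)) ≤ W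
    ∑-hit-pair (i , j) (i' , j') p≢q with j ≟ j' | i ≟ i'
    ... | no j≢j' | _ = ∑-columns≤ _ (λ x → ∑-hits j (L (x i)) (row-bijective (x i)) (λ y → L (x i') (y j'))
            (λ eq → cong (L (x i')) (eq j'))
            (λ y c → cong (L (x i')) (updateAt-minimal j' j y (j≢j' ∘ sym))))
    ... | yes _ | no i≢i' = ∑-rows≤ _ (λ y → ∑-hits i (λ r → L r (y j)) (col-bijective (y j))
            (λ x → L (x i') (y j'))
            (λ eq → cong (λ r → L r (y j')) (eq i'))
            (λ x c → cong (λ r → L r (y j')) (updateAt-minimal i' i x (i≢i' ∘ sym))))
    ... | yes refl | yes refl = contradiction refl p≢q

    W≥0 : 0ℤ ≤ W
    W≥0 = ≤-trans (+≤+ ℕ.z≤n) (length-placements≤ n k ℓ)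

    ∑-coll≤ : (ps : List (Fin k × Fin ℓ)) → Unique ps →
      + n * (∑[ P ∈ 𝒫 ] coll (map (read L P) ps)) ≤ + (length ps ℕ.* length ps) * W
    ∑-coll≤ [] _ = ≤-reflexive (trans (cong (+ n *_) (∑-zero 𝒫)) (*-zeroʳ (+ n)))
    ∑-coll≤ (p ∷ ps) (p≢ ∷ uniq) = begin
      + n * (∑[ P ∈ 𝒫 ] ((∑[ b ∈ map (read L P) ps ] χ (read L P p ≟ b)) + coll (map (read L P) ps)))
        ≡⟨ cong (+ n *_) (∑-+ 𝒫 _ _) ⟩
      + n * ((∑[ P ∈ 𝒫 ] ∑[ b ∈ map (read L P) ps ] χ (read L P p ≟ b)) + (∑[ P ∈ 𝒫 ] coll (map (read L P) ps)))
        ≡⟨ *-distribˡ-+ (+ n) _ _ ⟩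
      + n * (∑[ P ∈ 𝒫 ] ∑[ b ∈ map (read L P) ps ] χ (read L P p ≟ b)) + + n * (∑[ P ∈ 𝒫 ] coll (map (read L P) ps))
        ≤⟨ +-mono-≤ (first ps p≢) (∑-coll≤ ps uniq) ⟩
      + l * W + + (l ℕ.* l) * W
        ≡⟨ collect (+ l) (+ (l ℕ.* l)) W ⟩
      + (l ℕ.+ l ℕ.* l) * W
        ≤⟨ *-monoʳ-≤-nonNeg W {{nonNegative W≥0}} (+≤+ l+l²≤) ⟩
      + (suc l ℕ.* suc l) * W ∎
      where
      open ≤-Reasoning
      l = length ps
      collect : ∀ a b c → a * c + b * c ≡ (a + b) * c
      collect = solve-∀
      -- The head forms `l` pairs with the tail, and the pairs within the tail are at most `l * l`
      -- by induction.
      l+l²≤ : l ℕ.+ l ℕ.* l ℕ.≤ suc l ℕ.* suc l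
      l+l²≤ = ℕ.≤-trans (ℕ.≤-reflexive (sym (ℕ.*-suc l l))) (ℕ.m≤n+m (l ℕ.* suc l) (suc l))
      first : ∀ qs → All (p ≢_) qs →
        + n * (∑[ P ∈ 𝒫 ] ∑[ b ∈ map (read L P) qs ] χ (read L P p ≟ b)) ≤ + length qs * W
      first []       _            = ≤-reflexive (trans (cong (+ n *_) (∑-zero 𝒫)) (*-zeroʳ (+ n)))
      first (q ∷ qs) (p≢q ∷ p≢qs) = begin
        + n * (∑[ P ∈ 𝒫 ] (χ (read L P p ≟ read L P q) + (∑[ b ∈ map (read L P) qs ] χ (read L P p ≟ b))))
          ≡⟨ trans (cong (+ n *_) (∑-+ 𝒫 _ _)) (*-distribˡ-+ (+ n) _ _) ⟩
        + n * (∑[ P ∈ 𝒫 ] χ (read L P p ≟ read L P q)) + + n * (∑[ P ∈ 𝒫 ] ∑[ b ∈ map (read L P) qs ] χ (read L P p ≟ b))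
          ≤⟨ +-mono-≤ (∑-hit-pair p q p≢q) (first qs p≢qs) ⟩
        W + + length qs * W
          ≡⟨ one-more W (+ length qs) ⟩
        + suc (length qs) * W ∎
        where
        one-more : ∀ w a → w + a * w ≡ (1ℤ + a) * w
        one-more = solve-∀

    -- Here `v` is constant, later the word read by the other placement, so each coincidence is a
    -- hit of a fixed symbol. The two placements may overlap, since the bound counts placements for
    -- a fixed `v`.
    ∑-cross≤ : (ps : List (Fin k × Fin ℓ)) (v : List (Fin n)) →
      + n * (∑[ P ∈ 𝒫 ] cross (map (read L P) ps) v) ≤ + (length ps ℕ.* length v) * W
    ∑-cross≤ ps v = begin
      + n * (∑[ P ∈ 𝒫 ] cross (map (read L P) ps) v)
        ≡⟨ cong (+ n *_) (trans (∑-cong 𝒫 (λ P → ∑-map (read L P) ps _)) (trans (∑-swap 𝒫 ps _)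
             (∑-cong ps (λ p → ∑-swap 𝒫 v _)))) ⟩
      + n * (∑[ p ∈ ps ] ∑[ b ∈ v ] ∑[ P ∈ 𝒫 ] χ (read L P p ≟ b))
        ≡⟨ trans (sym (∑-*ˡ ps (+ n) _)) (∑-cong ps (λ p → sym (∑-*ˡ v (+ n) _))) ⟩
      (∑[ p ∈ ps ] ∑[ b ∈ v ] (+ n * (∑[ P ∈ 𝒫 ] χ (read L P p ≟ b))))
        ≤⟨ ∑≤length* ps (λ p → ∑≤length* v (λ b → ∑-hit-value p b)) ⟩
      + length ps * (+ length v * W)
        ≡⟨ trans (sym (*-assoc (+ length ps) (+ length v) W)) (cong (_* W) (sym (pos-* (length ps) (length v)))) ⟩
      + (length ps ℕ.* length v) * W ∎
      where open ≤-Reasoning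

-- Clearing denominators in rational inequalities

module Ratios where

  open import Data.Nat.Base as ℕ using (ℕ; suc)
  import Data.Nat.Properties as ℕ
  open import Data.Integer as ℤ using (ℤ; +_; +≤+)
  import Data.Integer.Properties as ℤ
  open import Data.Integer.Tactic.RingSolver using (solve-∀)
  open import Data.Rational as ℚ using (ℚ; mkℚ; 0ℚ; toℚᵘ; ∣_∣; _-_; _≤_; _<_; _/_)
  import Data.Rational.Properties as ℚ
  open import Data.Rational.Unnormalised as ℚᵘ using (ℚᵘ; mkℚᵘ; *≤*)
  import Data.Rational.Unnormalised.Properties as ℚᵘ
  open import Data.Product.Base using (∃; _,_)
  open import Relation.Binary.PropositionalEquality

  -- A positive rational has numerator at least 1, so the reciprocal of its own denominator lies
  -- below it.
  reciprocal-below : (ε : ℚ) → 0ℚ < ε → ∃ λ e → + 1 / suc e ≤ ε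
  reciprocal-below ε@(mkℚ (+ suc a) b _) _ = b , ℚ.toℚᵘ-cancel-≤ (begin
    toℚᵘ (+ 1 / suc b)  ≃⟨ ℚ.toℚᵘ-fromℚᵘ (mkℚᵘ (+ 1) b) ⟩
    mkℚᵘ (+ 1) b        ≤⟨ *≤* (ℤ.*-monoʳ-≤-nonNeg (+ suc b) (+≤+ (ℕ.s≤s (ℕ.z≤n {a})))) ⟩
    toℚᵘ ε              ∎)
    where open ℚᵘ.≤-Reasoning
  reciprocal-below (mkℚ (+ 0) _ _) (ℚ.*<* (ℤ.+<+ ()))
  reciprocal-below (mkℚ ℤ.-[1+ _ ] _ _) (ℚ.*<* ())

  -- The hypothesis is the conclusion multiplied by all three denominators. It serves both for the
  -- density against `1 / m !` and, with `m = 0`, for the proportion against 1.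
  ratio-close : ∀ x d m e → suc e ℕ.* ℤ.∣ + suc m ℤ.* + x ℤ.- + suc d ∣ ℕ.≤ suc m ℕ.* suc d →
                ∣ (x ÷ suc d) - (1 ÷ suc m) ∣ ≤ + 1 / suc e
  ratio-close x d m e close = ℚ.toℚᵘ-cancel-≤ (begin
    toℚᵘ ∣ (x ÷ suc d) - (1 ÷ suc m) ∣
      ≃⟨ ℚ.toℚᵘ-homo-∣-∣ ((x ÷ suc d) - (1 ÷ suc m)) ⟩
    ℚᵘ.∣ toℚᵘ ((x ÷ suc d) - (1 ÷ suc m)) ∣
      ≃⟨ ℚᵘ.∣-∣-cong (ℚ.toℚᵘ-homo-+ (x ÷ suc d) (ℚ.- (1 ÷ suc m))) ⟩
    ℚᵘ.∣ toℚᵘ (x ÷ suc d) ℚᵘ.+ toℚᵘ (ℚ.- (1 ÷ suc m)) ∣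
      ≃⟨ ℚᵘ.∣-∣-cong (ℚᵘ.+-cong (ℚ.toℚᵘ-fromℚᵘ (mkℚᵘ (+ x) d))
           (ℚᵘ.≃-trans (ℚ.toℚᵘ-homo‿- (1 ÷ suc m)) (ℚᵘ.-‿cong (ℚ.toℚᵘ-fromℚᵘ (mkℚᵘ (+ 1) m))))) ⟩
    ℚᵘ.∣ mkℚᵘ (+ x) d ℚᵘ.- mkℚᵘ (+ 1) m ∣
      ≤⟨ *≤* cross-multiplied ⟩
    mkℚᵘ (+ 1) e
      ≃⟨ ℚ.toℚᵘ-fromℚᵘ (mkℚᵘ (+ 1) e) ⟨
    toℚᵘ (+ 1 / suc e) ∎)
    where
    open ℚᵘ.≤-Reasoning
    numerator : ∀ m x d → m ℤ.* x ℤ.- d ≡ x ℤ.* m ℤ.+ ℤ.-[1+ 0 ] ℤ.* d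
    numerator = solve-∀
    cross-multiplied : + ℤ.∣ + x ℤ.* + suc m ℤ.+ ℤ.-[1+ 0 ] ℤ.* + suc d ∣ ℤ.* + suc e ℤ.≤
                       + 1 ℤ.* + (suc d ℕ.* suc m)
    cross-multiplied = subst₂ ℤ._≤_
      (trans (ℤ.pos-* (suc e) _) (trans (ℤ.*-comm (+ suc e) _)
        (cong (λ i → + ℤ.∣ i ∣ ℤ.* + suc e) (numerator (+ suc m) (+ x) (+ suc d)))))
      (trans (cong +_ (ℕ.*-comm (suc m) (suc d))) (sym (ℤ.*-identityˡ _)))
      (+≤+ close)

-- Second moment of the number of occurrences

module Moment where

  open import Data.Nat.Base as ℕ using (ℕ; suc; _!)
  import Data.Nat.Properties as ℕ
  open import Data.Integer
    using (ℤ; 0ℤ; 1ℤ; +_; _+_; _*_; _-_; _≤_; +≤+; -≤+; -[1+_]; -_; ∣_∣; nonNegative; NonNegative)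
  open import Data.Integer.Properties
    using (*-identityˡ; *-identityʳ; *-zeroʳ; +-identityʳ; ≤-refl; ≤-reflexive; ≤-trans; +-mono-≤;
           +-monoʳ-≤; *-monoˡ-≤-nonNeg; *-monoʳ-≤-nonNeg; pos-*; abs-*; module ≤-Reasoning)
  open import Data.Integer.Tactic.RingSolver using (solve-∀)
  open import Data.Fin.Base using (Fin)
  open import Data.Fin.Properties using (_≟_)
  open import Data.List.Base using (List; _++_; length; filter; allFin; map)
  open import Data.List.Properties using (length-tabulate; length-map; map-∘)
  open import Data.List.Membership.Propositional.Properties using (∈-filter⁻)
  open import Data.List.Relation.Unary.Unique.Propositional using (Unique)
  open import Data.List.Relation.Unary.Unique.Propositional.Properties using (map⁺; allFin⁺)
  open import Data.List.Relation.Unary.Unique.DecPropositional using (unique?)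
  open import Data.Product.Base using (_×_; _,_; proj₁; proj₂)
  open import Function.Base using (_∘_; id)
  open import Relation.Nullary using (Dec; yes; no)
  open import Relation.Binary.PropositionalEquality

  open Sums
  open Words
  open Exchange
  open Functions
  open Latin
  open Orders
  open Collisions

  private variable
    k ℓ n : ℕ

  i≤+∣i∣ : ∀ i → i ≤ + ∣ i ∣
  i≤+∣i∣ (+ n)        = ≤-refl
  i≤+∣i∣ (-[1+ n ]) = -≤+

  ∣aχ-1∣≤a : {P : Set} (a : ℕ) → 1 ℕ.≤ a → (P? : Dec P) → ∣ + a * χ P? - 1ℤ ∣ ℕ.≤ a
  ∣aχ-1∣≤a (suc a) _ P?@(yes x) = begin
    ∣ + suc a * χ P? - 1ℤ ∣ ≡⟨ cong (λ c → ∣ + suc a * c - 1ℤ ∣) (χ-yes P? x) ⟩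
    ∣ + suc a * 1ℤ - 1ℤ ∣   ≡⟨ cong (λ c → ∣ c - 1ℤ ∣) (*-identityʳ (+ suc a)) ⟩
    a                       ≤⟨ ℕ.n≤1+n a ⟩
    suc a                   ∎
    where open ℕ.≤-Reasoning
  ∣aχ-1∣≤a (suc a) 1≤ P?@(no ¬x) = begin
    ∣ + suc a * χ P? - 1ℤ ∣ ≡⟨ cong (λ c → ∣ + suc a * c - 1ℤ ∣) (χ-no P? ¬x) ⟩
    ∣ + suc a * 0ℤ - 1ℤ ∣   ≡⟨ cong (λ c → ∣ c - 1ℤ ∣) (*-zeroʳ (+ suc a)) ⟩
    1                       ≤⟨ 1≤ ⟩
    suc a                   ∎
    where open ℕ.≤-Reasoning

  hits : {A : Matrix (Fin (k ℕ.* ℓ)) k ℓ} → Matrix (Fin n) n n → ℕ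
  hits {k} {ℓ} {n} {A} L =
    length (filter (λ P → ordEquiv? A (submatrix L (proj₁ P) (proj₂ P))) (placements n k ℓ))

  module _ {k ℓ : ℕ} {A : Matrix (Fin (k ℕ.* ℓ)) k ℓ} (pos : Positions A) (n : ℕ) where
    open Positions pos

    private
      m = k ℕ.* ℓ
      𝒫 = placements n k ℓ
      W = all-placements n k ℓ
      M = + (m !)
      LS = latinSquares n

      ps : List (Fin k × Fin ℓ)
      ps = map position (allFin m)

      ps-unique : Unique ps
      ps-unique = map⁺ position-injective (allFin⁺ m)

      length-ps : length ps ≡ m
      length-ps = trans (length-map position (allFin m)) (length-tabulate {n = m} id)

    word : Matrix (Fin n) n n → Placement n k ℓ → List (Fin n)
    word L P = map (read L P) ps

    word≡ : ∀ L P → map (entry L) (map (cell P) ps) ≡ word L P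
    word≡ L P = sym (map-∘ ps)

    excess : List (Fin n) → ℤ
    excess u = M * inc u - 1ℤ

    -- Equals `M * length 𝒫` times the difference between the density of `A` among the placements
    -- and `1 / m !`, hence an integer.
    deviation : Matrix (Fin n) n n → ℤ
    deviation L = M * + hits {A = A} L - + length 𝒫

    deviation≡∑excess : ∀ L → deviation L ≡ (∑[ P ∈ 𝒫 ] excess (word L P))
    deviation≡∑excess L = sym (begin
      (∑[ P ∈ 𝒫 ] (M * inc (word L P) - 1ℤ))
        ≡⟨ ∑-+ 𝒫 _ _ ⟩
      (∑[ P ∈ 𝒫 ] (M * inc (word L P))) + (∑[ _ ∈ 𝒫 ] (- 1ℤ))
        ≡⟨ cong₂ _+_ (∑-*ˡ 𝒫 M (λ P → inc (word L P))) (∑-const 𝒫 (- 1ℤ)) ⟩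
      M * (∑[ P ∈ 𝒫 ] inc (word L P)) + + length 𝒫 * (- 1ℤ)
        ≡⟨ cong (λ s → M * s + + length 𝒫 * (- 1ℤ)) (trans
             (∑-cong 𝒫 (λ P → sym (trans (ordEquiv-inc pos (submatrix L (proj₁ P) (proj₂ P)))
                                         (cong inc (map-∘ (allFin m))))))
             (sym (length-filter≡∑ (λ P → ordEquiv? A (submatrix L (proj₁ P) (proj₂ P))) 𝒫))) ⟩
      M * + hits {A = A} L + + length 𝒫 * (- 1ℤ)
        ≡⟨ tidy (M * + hits {A = A} L) (+ length 𝒫) ⟩
      deviation L ∎)
      where
      open ≡-Reasoning
      tidy : ∀ a d → a + d * (- 1ℤ) ≡ a - d
      tidy = solve-∀

    -- Conditionally on all the entries read by P and Q being distinct, the excesses at P and Q are uncorrelated.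
    uncorrelated : ∀ P Q →
      (∑[ L ∈ LS ] (U (word L P ++ word L Q) * (excess (word L P) * excess (word L Q)))) ≡ 0ℤ
    uncorrelated P Q = begin
      (∑[ L ∈ LS ] (U (word L P ++ word L Q) * (excess (word L P) * excess (word L Q))))
        ≡⟨ ∑-cong LS (λ L → expand (U (word L P ++ word L Q)) M (inc (word L P)) (excess (word L Q))) ⟩
      (∑[ L ∈ LS ] (M * hit L + - 1ℤ * all L))
        ≡⟨ trans (∑-+ LS _ _) (cong₂ _+_ (∑-*ˡ LS M hit) (∑-*ˡ LS (- 1ℤ) all)) ⟩
      M * ∑ LS hit + - 1ℤ * ∑ LS all
        ≡⟨ cong (_+ - 1ℤ * ∑ LS all) balanced ⟩
      ∑ LS all + - 1ℤ * ∑ LS all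
        ≡⟨ cancel (∑ LS all) ⟩
      0ℤ ∎
      where
      open ≡-Reasoning
      hit all : Matrix (Fin n) n n → ℤ
      hit L = uniqueΦ (λ u v → inc u * excess v) (word L P) (word L Q)
      all L = uniqueΦ (λ u v → excess v) (word L P) (word L Q)
      expand : ∀ u a i e → u * ((a * i - 1ℤ) * e) ≡ a * (u * (i * e)) + - 1ℤ * (u * e)
      expand = solve-∀
      cancel : ∀ a → a + - 1ℤ * a ≡ 0ℤ
      cancel = solve-∀
      -- Only the excess at `P` has been expanded: the cells of `P` form the word to be ordered, and
      -- the excess at `Q` is the weight `g` on the remaining letters. If `P` and `Q` share a cell,
      -- the distinctness weight makes both sides agree trivially when `m > 0`.
      balanced : M * ∑ LS hit ≡ ∑ LS all
      balanced = begin
        M * ∑ LS hit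
          ≡⟨ cong₂ _*_ (cong (λ l → + (l !)) (sym (trans (length-map (cell P) ps) length-ps)))
               (∑-cong LS (λ L → sym (cong₂ (uniqueΦ (λ u v → inc u * excess v)) (word≡ L P) (word≡ L Q)))) ⟩
        + (length (map (cell P) ps) !) * (∑[ L ∈ LS ] uniqueΦ (λ u v → inc u * excess v)
            (map (entry L) (map (cell P) ps)) (map (entry L) (map (cell Q) ps)))
          ≡⟨ increasing-count LS entry (latin-relabelInvariant n) excess (map (cell P) ps) (map (cell Q) ps) ⟩
        (∑[ L ∈ LS ] uniqueΦ (λ u v → excess v) (map (entry L) (map (cell P) ps)) (map (entry L) (map (cell Q) ps)))
          ≡⟨ ∑-cong LS (λ L → cong₂ (uniqueΦ (λ u v → excess v)) (word≡ L P) (word≡ L Q)) ⟩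
        ∑ LS all ∎

    excess²≤ : ∀ u v → excess u * excess v ≤ M * M
    excess²≤ u v = begin
      excess u * excess v                ≤⟨ i≤+∣i∣ _ ⟩
      + ∣ excess u * excess v ∣          ≡⟨ cong +_ (abs-* (excess u) (excess v)) ⟩
      + (∣ excess u ∣ ℕ.* ∣ excess v ∣)
        ≤⟨ +≤+ (ℕ.*-mono-≤ (∣aχ-1∣≤a (m !) (ℕ.1≤n! m) _) (∣aχ-1∣≤a (m !) (ℕ.1≤n! m) _)) ⟩
      + (m ! ℕ.* m !)                    ≡⟨ pos-* (m !) (m !) ⟩
      M * M                              ∎
      where open ≤-Reasoning

    collisions : Matrix (Fin n) n n → Placement n k ℓ → Placement n k ℓ → ℤ
    collisions L P Q = coll (word L P) + cross (word L P) (word L Q) + coll (word L Q)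

    -- If all entries read are distinct, the first summand is already the whole product. Otherwise
    -- it vanishes, and at least one coincidence pays for the crude bound `M * M`.
    excess²-split : ∀ L P Q → excess (word L P) * excess (word L Q) ≤
      U (word L P ++ word L Q) * (excess (word L P) * excess (word L Q)) + M * M * collisions L P Q
    excess²-split L P Q = subst (λ c → e ≤ U w * e + M * M * c) (coll-++ (word L P) (word L Q)) (go (unique? _≟_ w))
      where
      open ≤-Reasoning
      w = word L P ++ word L Q
      e = excess (word L P) * excess (word L Q)
      instance
        M²≥0 : NonNegative (M * M)
        M²≥0 = nonNegative (≤-trans (+≤+ ℕ.z≤n) (≤-reflexive (pos-* (m !) (m !))))
      go : Dec (Unique w) → e ≤ U w * e + M * M * coll w
      go (yes uniq) = begin
        e                            ≡⟨ trans (cong (_* e) (χ-yes (unique? _≟_ w) uniq)) (*-identityˡ e) ⟨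
        U w * e                      ≡⟨ trans (cong (λ s → U w * e + s) (*-zeroʳ (M * M))) (+-identityʳ _) ⟨
        U w * e + M * M * 0ℤ         ≤⟨ +-monoʳ-≤ (U w * e) (*-monoˡ-≤-nonNeg (M * M) (coll≥0 w)) ⟩
        U w * e + M * M * coll w     ∎
      go (no ¬uniq) = begin
        e                            ≤⟨ excess²≤ (word L P) (word L Q) ⟩
        M * M                        ≡⟨ *-identityʳ (M * M) ⟨
        M * M * 1ℤ                   ≤⟨ *-monoˡ-≤-nonNeg (M * M) (unique-or-coll w) ⟩
        M * M * (U w + coll w)       ≡⟨ cong (λ c → M * M * (c + coll w)) U≡0 ⟩
        M * M * (0ℤ + coll w)        ≡⟨ tidy (M * M) e (coll w) ⟩
        0ℤ * e + M * M * coll w      ≡⟨ cong (λ c → c * e + M * M * coll w) U≡0 ⟨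
        U w * e + M * M * coll w     ∎
        where
        U≡0 = χ-no (unique? _≟_ w) ¬uniq
        tidy : ∀ a e c → a * (0ℤ + c) ≡ 0ℤ * e + a * c
        tidy = solve-∀

    -- The factor 3 stands for coincidences within `P`, between `P` and `Q`, and within `Q`; each
    -- kind involves at most `m * m` pairs of cells. The estimate holds for every single Latin
    -- square, not merely on average.
    ∑-collisions≤ : ∀ L → IsLatin n L →
      + n * (∑[ P ∈ 𝒫 ] ∑[ Q ∈ 𝒫 ] collisions L P Q) ≤ + 3 * + (m ℕ.* m) * (W * W)
    ∑-collisions≤ L L-latin = begin
      + n * (∑[ P ∈ 𝒫 ] ∑[ Q ∈ 𝒫 ] collisions L P Q)
        ≡⟨ cong (+ n *_) (trans (∑-cong 𝒫 (λ P → trans (∑-+ 𝒫 _ _) (cong (_+ c) (∑-+ 𝒫 _ _))))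
             (trans (∑-+ 𝒫 _ _) (cong₂ _+_ (∑-+ 𝒫 _ _) (∑-const 𝒫 c)))) ⟩
      + n * ((∑[ P ∈ 𝒫 ] ∑[ Q ∈ 𝒫 ] coll (word L P)) + (∑[ P ∈ 𝒫 ] ∑[ Q ∈ 𝒫 ] cross (word L P) (word L Q)) + D * c)
        ≡⟨ cong (λ s → + n * (s + (∑[ P ∈ 𝒫 ] ∑[ Q ∈ 𝒫 ] cross (word L P) (word L Q)) + D * c))
             (trans (∑-cong 𝒫 (λ P → ∑-const 𝒫 _)) (∑-*ˡ 𝒫 D _)) ⟩
      + n * (D * c + (∑[ P ∈ 𝒫 ] ∑[ Q ∈ 𝒫 ] cross (word L P) (word L Q)) + D * c)
        ≡⟨ spread (+ n) D c _ ⟩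
      D * (+ n * c) + + n * (∑[ P ∈ 𝒫 ] ∑[ Q ∈ 𝒫 ] cross (word L P) (word L Q)) + D * (+ n * c)
        ≡⟨ cong (λ s → D * (+ n * c) + s + D * (+ n * c))
             -- With `Q` outermost, the word that it reads is constant while `P` varies, as
             -- `∑-cross≤` requires.
             (trans (cong (+ n *_) (∑-swap 𝒫 𝒫 _)) (sym (∑-*ˡ 𝒫 (+ n) _))) ⟩
      D * (+ n * c) + (∑[ Q ∈ 𝒫 ] (+ n * (∑[ P ∈ 𝒫 ] cross (word L P) (word L Q)))) + D * (+ n * c)
        ≤⟨ +-mono-≤ (+-mono-≤ within (∑≤length* 𝒫 between)) within ⟩
      D * B + D * B + D * B
        ≡⟨ collect D B ⟩
      D * (+ 3 * B)
        ≤⟨ *-monoʳ-≤-nonNeg (+ 3 * B) {{nonNegative 3B≥0}} (length-placements≤ n k ℓ) ⟩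
      W * (+ 3 * B)
        ≡⟨ regroup W (+ (m ℕ.* m)) ⟩
      + 3 * + (m ℕ.* m) * (W * W) ∎
      where
      open ≤-Reasoning
      D = + length 𝒫
      B = + (m ℕ.* m) * W
      c = ∑[ Q ∈ 𝒫 ] coll (word L Q)
      spread : ∀ n d c s → n * (d * c + s + d * c) ≡ d * (n * c) + n * s + d * (n * c)
      spread = solve-∀
      collect : ∀ d b → d * b + d * b + d * b ≡ d * (+ 3 * b)
      collect = solve-∀
      regroup : ∀ w s → w * (+ 3 * (s * w)) ≡ + 3 * s * (w * w)
      regroup = solve-∀
      3B≥0 : 0ℤ ≤ + 3 * B
      3B≥0 = *-monoˡ-≤-nonNeg (+ 3) (≤-trans (≤-reflexive (sym (*-zeroʳ (+ (m ℕ.* m)))))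
               (*-monoˡ-≤-nonNeg (+ (m ℕ.* m)) (W≥0 L L-latin k ℓ)))
      within : D * (+ n * c) ≤ D * B
      within = *-monoˡ-≤-nonNeg D
        (subst (λ l → + n * c ≤ + (l ℕ.* l) * W) length-ps (∑-coll≤ L L-latin k ℓ ps ps-unique))
      between : ∀ Q → + n * (∑[ P ∈ 𝒫 ] cross (word L P) (word L Q)) ≤ B
      between Q = subst₂ (λ l l' → + n * (∑[ P ∈ 𝒫 ] cross (word L P) (word L Q)) ≤ + (l ℕ.* l') * W)
        length-ps (trans (length-map (read L Q) ps) length-ps) (∑-cross≤ L L-latin k ℓ ps (word L Q))

    -- The two parts of `excess²-split` need opposite orders of summation: the distinct part cancels
    -- for each pair of placements only after summing over the squares, while the collision part is
    -- bounded for each square after summing over the pairs.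
    second-moment : + n * (∑[ L ∈ LS ] (deviation L * deviation L)) ≤
                    + length LS * (M * M * (+ 3 * + (m ℕ.* m) * (W * W)))
    second-moment = begin
      + n * (∑[ L ∈ LS ] (deviation L * deviation L))
        ≡⟨ cong (+ n *_) (∑-cong LS square) ⟩
      + n * (∑[ L ∈ LS ] ∑[ P ∈ 𝒫 ] ∑[ Q ∈ 𝒫 ] e L P Q)
        ≤⟨ *-monoˡ-≤-nonNeg (+ n) (∑-mono LS (λ L → ∑-mono 𝒫 (λ P → ∑-mono 𝒫 (excess²-split L P)))) ⟩
      + n * (∑[ L ∈ LS ] ∑[ P ∈ 𝒫 ] ∑[ Q ∈ 𝒫 ] (g L P Q + M * M * collisions L P Q))
        ≡⟨ cong (+ n *_) (trans
             (∑-cong LS (λ L → trans (∑-cong 𝒫 (λ P → ∑-+ 𝒫 _ _)) (∑-+ 𝒫 _ _)))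
             (trans (∑-+ LS _ _) (cong₂ _+_ vanish
               (trans (∑-cong LS (λ L → trans (∑-cong 𝒫 (λ P → ∑-*ˡ 𝒫 (M * M) _)) (∑-*ˡ 𝒫 (M * M) _)))
                      (∑-*ˡ LS (M * M) _))))) ⟩
      + n * (0ℤ + M * M * (∑[ L ∈ LS ] ∑[ P ∈ 𝒫 ] ∑[ Q ∈ 𝒫 ] collisions L P Q))
        ≡⟨ trans (regroup (+ n) (M * M) _) (cong (M * M *_) (sym (∑-*ˡ LS (+ n) _))) ⟩
      M * M * (∑[ L ∈ LS ] (+ n * (∑[ P ∈ 𝒫 ] ∑[ Q ∈ 𝒫 ] collisions L P Q)))
        ≤⟨ *-monoˡ-≤-nonNeg (M * M) {{M²≥0}} (∑-mono-∈ LS (λ {L} L∈ →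
             ∑-collisions≤ L (proj₂ (∈-filter⁻ (isLatin? n) {xs = allSquares n} L∈)))) ⟩
      M * M * (∑[ L ∈ LS ] C)
        ≡⟨ cong (M * M *_) (∑-const LS C) ⟩
      M * M * (+ length LS * C)
        ≡⟨ swap-factors (M * M) (+ length LS) C ⟩
      + length LS * (M * M * C) ∎
      where
      open ≤-Reasoning
      C = + 3 * + (m ℕ.* m) * (W * W)
      e g : Matrix (Fin n) n n → Placement n k ℓ → Placement n k ℓ → ℤ
      e L P Q = excess (word L P) * excess (word L Q)
      g L P Q = U (word L P ++ word L Q) * e L P Q
      M²≥0 : NonNegative (M * M)
      M²≥0 = nonNegative (≤-trans (+≤+ ℕ.z≤n) (≤-reflexive (pos-* (m !) (m !))))
      regroup : ∀ n a s → n * (0ℤ + a * s) ≡ a * (n * s)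
      regroup = solve-∀
      swap-factors : ∀ a b c → a * (b * c) ≡ b * (a * c)
      swap-factors = solve-∀
      square : ∀ L → deviation L * deviation L ≡ (∑[ P ∈ 𝒫 ] ∑[ Q ∈ 𝒫 ] e L P Q)
      square L = trans (cong₂ _*_ (deviation≡∑excess L) (deviation≡∑excess L))
        (trans (sym (∑-*ʳ 𝒫 _ _)) (∑-cong 𝒫 (λ P → sym (∑-*ˡ 𝒫 (excess (word L P)) _))))
      vanish : (∑[ L ∈ LS ] ∑[ P ∈ 𝒫 ] ∑[ Q ∈ 𝒫 ] g L P Q) ≡ 0ℤ
      vanish = trans (∑-swap LS 𝒫 _) (trans (∑-cong 𝒫 (λ P → trans (∑-swap LS 𝒫 (λ L Q → g L P Q))
        (trans (∑-cong 𝒫 (uncorrelated P)) (∑-zero 𝒫)))) (∑-zero 𝒫))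

-- Chebyshev's inequality and the limit

module Main where

  open import Data.Nat.Base as ℕ using (ℕ; zero; suc; _!; _^_)
  import Data.Nat.Properties as ℕ
  import Algebra.Properties.CommutativeSemigroup ℕ.*-commutativeSemigroup as ℕ*
  open import Data.Nat.Combinatorics using (_C_)
  open import Data.Integer
    using (0ℤ; 1ℤ; +_; _+_; _*_; _-_; -_; _≤_; +≤+; -[1+_]; ∣_∣; nonNegative; drop‿+≤+)
  open import Data.Integer.Properties
    using (*-identityˡ; *-assoc; *-comm; ≤-reflexive; ≤-trans; *-monoˡ-≤-nonNeg; *-monoʳ-≤-nonNeg;
           pos-*; pos-+; +-injective; ∣-i∣≡∣i∣; module ≤-Reasoning)
  open import Data.Integer.Tactic.RingSolver using (solve-∀)
  open import Data.Fin.Base using (Fin)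
  open import Data.List.Base using (length; filter)
  open import Data.Rational as ℚ using (ℚ; 1ℚ; _/_)
  import Data.Rational.Properties as ℚ
  open import Relation.Nullary using (Dec; yes; no; ¬_; ¬?; contradiction)
  open import Relation.Binary.PropositionalEquality

  open Sums
  open Functions
  open Latin
  open Orders
  open Collisions
  open Ratios
  open Moment

  ∣i∣*∣i∣≡i*i : ∀ i → + ∣ i ∣ * + ∣ i ∣ ≡ i * i
  ∣i∣*∣i∣≡i*i (+ n)    = refl
  ∣i∣*∣i∣≡i*i -[1+ n ] = refl

  module _ (k ℓ : ℕ) where

    private
      m = k ℕ.* ℓ

    -- The loss in replacing `n ^ k` and `n ^ ℓ` by the numbers of increasing sequences, as in
    -- `^≤incSeqs`.
    shape-factor : ℕ
    shape-factor = 2 ^ k ℕ.* k ! ℕ.* (2 ^ ℓ ℕ.* ℓ !)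

    all-placements≤ : ∀ n → 2 ℕ.* k ℕ.≤ n → 2 ℕ.* ℓ ℕ.≤ n →
      all-placements n k ℓ ≤ + shape-factor * + length (placements n k ℓ)
    all-placements≤ n 2k≤n 2ℓ≤n = begin
      + (n ^ k) * + (n ^ ℓ)
        ≤⟨ *-monoʳ-≤-nonNeg (+ (n ^ ℓ)) (^≤incSeqs n k 2k≤n) ⟩
      a * x * + (n ^ ℓ)
        ≤⟨ *-monoˡ-≤-nonNeg (a * x) {{nonNegative a*x≥0}} (^≤incSeqs n ℓ 2ℓ≤n) ⟩
      a * x * (b * y)
        ≡⟨ interchange a x b y ⟩
      a * b * (x * y)
        ≡⟨ cong₂ _*_ (pos-* (2 ^ k ℕ.* k !) (2 ^ ℓ ℕ.* ℓ !)) (length-placements n k ℓ) ⟨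
      + shape-factor * + length (placements n k ℓ) ∎
      where
      open ≤-Reasoning
      a = + (2 ^ k ℕ.* k !)
      b = + (2 ^ ℓ ℕ.* ℓ !)
      x = + length (incSeqs n k)
      y = + length (incSeqs n ℓ)
      interchange : ∀ a x b y → a * x * (b * y) ≡ a * b * (x * y)
      interchange = solve-∀
      a*x≥0 : 0ℤ ≤ a * x
      a*x≥0 = ≤-trans (+≤+ ℕ.z≤n) (≤-reflexive (pos-* (2 ^ k ℕ.* k !) (length (incSeqs n k))))

    -- By Chebyshev's inequality, a fraction of at most this divided by n of the Latin squares of order n
    -- has a pattern density further than 1 / (1 + e) from 1 / m!.
    chebyshev-factor : ℕ → ℕ
    chebyshev-factor e =
      suc e ℕ.* suc e ℕ.* (m ! ℕ.* m ! ℕ.* (3 ℕ.* (m ℕ.* m))) ℕ.* (shape-factor ℕ.* shape-factor)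

    -- The first summand makes the exceptional fraction at most `1 / suc d`, the second ensures
    -- `2 * k ≤ n` and `2 * ℓ ≤ n`. The `suc` around the Chebyshev factor keeps the order positive
    -- even when that factor is 0, as for `m = 0`.
    threshold : ℕ → ℕ → ℕ
    threshold e d = suc d ℕ.* suc (chebyshev-factor e) ℕ.+ (2 ℕ.* k ℕ.+ 2 ℕ.* ℓ)

    module _ {A : Matrix (Fin m) k ℓ} (A∈R : InR k ℓ A) (ε : ℚ) (e : ℕ) (1/e≤ε : + 1 / suc e ℚ.≤ ε)
             (n : ℕ) (0<n : 0 ℕ.< n) (2k≤n : 2 ℕ.* k ℕ.≤ n) (2ℓ≤n : 2 ℕ.* ℓ ℕ.≤ n) where

      private
        pos = InR⇒Positions A A∈R
        LS = latinSquares n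
        D = length (placements n k ℓ)
        K = shape-factor

      close? : (L : Matrix (Fin n) n n) → Dec (ℚ.∣ t A L ℚ.- (1 ÷ (m !)) ∣ ℚ.≤ ε)
      close? L = ℚ.∣ t A L ℚ.- (1 ÷ (m !)) ∣ ℚ.≤? ε

      D>0 : 0 ℕ.< D
      D>0 = ℕ.n≢0⇒n>0 λ D≡0 → ℕ.<⇒≱ (ℕ.*-mono-≤ (ℕ.m^n>0 n k) (ℕ.m^n>0 n ℓ)) (drop‿+≤+ (begin
        + (n ^ k ℕ.* n ^ ℓ)     ≡⟨ pos-* (n ^ k) (n ^ ℓ) ⟩
        all-placements n k ℓ    ≤⟨ all-placements≤ n 2k≤n 2ℓ≤n ⟩
        + K * + D               ≡⟨ cong (λ d → + K * + d) D≡0 ⟩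
        + K * 0ℤ                ≡⟨ *-comm (+ K) 0ℤ ⟩
        0ℤ                      ∎))
        where
        open ≤-Reasoning
        instance _ = ℕ.>-nonZero 0<n

      D≡C*C : D ≡ (n C k) ℕ.* (n C ℓ)
      D≡C*C = +-injective (trans (length-placements n k ℓ) (trans
        (sym (pos-* (length (incSeqs n k)) (length (incSeqs n ℓ))))
        (cong +_ (cong₂ ℕ._*_ (length-incSeqs (ℕ.≤-trans (ℕ.m≤n*m k 2) 2k≤n))
                              (length-incSeqs (ℕ.≤-trans (ℕ.m≤n*m ℓ 2) 2ℓ≤n))))))

      small-deviation⇒close : ∀ L → suc e ℕ.* ∣ deviation pos n L ∣ ℕ.≤ m ! ℕ.* D →
                              ℚ.∣ t A L ℚ.- (1 ÷ (m !)) ∣ ℚ.≤ ε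
      small-deviation⇒close L small = ℚ.≤-trans (go (m !) D ((n C k) ℕ.* (n C ℓ)) D≡C*C D>0 (ℕ.1≤n! m) small) 1/e≤ε
        where
        -- The factorial and the numbers of placements are generalised so that matching on `suc`
        -- lets `÷` compute.
        go : ∀ M d c → d ≡ c → 0 ℕ.< d → 0 ℕ.< M → suc e ℕ.* ∣ + M * + hits {A = A} L - + d ∣ ℕ.≤ M ℕ.* d →
             ℚ.∣ (hits {A = A} L ÷ c) ℚ.- (1 ÷ M) ∣ ℚ.≤ + 1 / suc e
        go (suc M) (suc d) _ refl _ _ = ratio-close (hits {A = A} L) d M e

      -- The pointwise inequality behind Chebyshev: on a far square, `suc e` times the absolute
      -- deviation is at least `D`, so its square dominates `D * D`.
      far-bound : ∀ L → χ (¬? (close? L)) * (+ D * + D) ≤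
                        + (suc e ℕ.* suc e) * (deviation pos n L * deviation pos n L)
      far-bound L = go (¬? (close? L))
        where
        open ≤-Reasoning
        δ = deviation pos n L
        rhs : + (suc e ℕ.* suc e ℕ.* (∣ δ ∣ ℕ.* ∣ δ ∣)) ≡ + (suc e ℕ.* suc e) * (δ * δ)
        rhs = trans (pos-* (suc e ℕ.* suc e) _)
          (cong (+ (suc e ℕ.* suc e) *_) (trans (pos-* (∣ δ ∣) (∣ δ ∣)) (∣i∣*∣i∣≡i*i δ)))
        go : (far? : Dec (¬ (ℚ.∣ t A L ℚ.- (1 ÷ (m !)) ∣ ℚ.≤ ε))) →
             χ far? * (+ D * + D) ≤ + (suc e ℕ.* suc e) * (δ * δ)
        go (no ¬far) = begin
          χ (no ¬far) * (+ D * + D)                   ≡⟨ cong (_* (+ D * + D)) (χ-no (no ¬far) ¬far) ⟩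
          0ℤ                                          ≤⟨ +≤+ ℕ.z≤n ⟩
          + (suc e ℕ.* suc e ℕ.* (∣ δ ∣ ℕ.* ∣ δ ∣))   ≡⟨ rhs ⟩
          + (suc e ℕ.* suc e) * (δ * δ)               ∎
        go (yes far) = begin
          χ (yes far) * (+ D * + D)                   ≡⟨ cong (_* (+ D * + D)) (χ-yes (yes far) far) ⟩
          1ℤ * (+ D * + D)                            ≡⟨ *-identityˡ _ ⟩
          + D * + D                                   ≡⟨ pos-* D D ⟨
          + (D ℕ.* D)                                 ≤⟨ +≤+ (ℕ.*-mono-≤ D≤ D≤) ⟩
          + (suc e ℕ.* ∣ δ ∣ ℕ.* (suc e ℕ.* ∣ δ ∣))   
            ≡⟨ cong +_ (ℕ.[m*n]*[o*p]≡[m*o]*[n*p] (suc e) (∣ δ ∣) (suc e) (∣ δ ∣)) ⟩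
          + (suc e ℕ.* suc e ℕ.* (∣ δ ∣ ℕ.* ∣ δ ∣))   ≡⟨ rhs ⟩
          + (suc e ℕ.* suc e) * (δ * δ)               ∎
          where
          D≤ : D ℕ.≤ suc e ℕ.* ∣ δ ∣
          -- Being far even gives the lower bound `m ! * D`; the factor `m !` is given up.
          D≤ = ℕ.≤-trans (ℕ.m≤n*m D (m !) {{ℕ.>-nonZero (ℕ.1≤n! m)}})
                 (ℕ.<⇒≤ (ℕ.≰⇒> (λ small → far (small-deviation⇒close L small))))

      far-count : ℕ
      far-count = length (filter (λ L → ¬? (close? L)) LS)

      -- Summing `far-bound` gives the claim multiplied by `D * D`. The second moment is bounded in
      -- terms of `W * W`, and `W ≤ K * D` turns this into `K * K * (D * D)`, so that `D * D`
      -- cancels.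
      far-count-bound : n ℕ.* far-count ℕ.≤ length LS ℕ.* chebyshev-factor e
      far-count-bound = ℕ.*-cancelʳ-≤ _ _ (D ℕ.* D) {{ℕ.>-nonZero (ℕ.*-mono-≤ D>0 D>0)}} (drop‿+≤+ (begin
        + (n ℕ.* far-count ℕ.* (D ℕ.* D))
          ≡⟨ pos-*₄ n far-count D D ⟩
        + n * + far-count * (+ D * + D)
          ≡⟨ *-assoc (+ n) (+ far-count) (+ D * + D) ⟩
        + n * (+ far-count * (+ D * + D))
          ≡⟨ cong (+ n *_) (trans (cong (_* (+ D * + D)) (length-filter≡∑ (λ L → ¬? (close? L)) LS))
                                  (sym (∑-*ʳ LS _ _))) ⟩
        + n * (∑[ L ∈ LS ] (χ (¬? (close? L)) * (+ D * + D)))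
          ≤⟨ *-monoˡ-≤-nonNeg (+ n) (∑-mono LS far-bound) ⟩
        + n * (∑[ L ∈ LS ] (E * (deviation pos n L * deviation pos n L)))
          ≡⟨ trans (cong (+ n *_) (∑-*ˡ LS E _)) (swap-factors (+ n) E _) ⟩
        E * (+ n * (∑[ L ∈ LS ] (deviation pos n L * deviation pos n L)))
          ≤⟨ *-monoˡ-≤-nonNeg E (second-moment pos n) ⟩
        E * (T * (+ (m !) * + (m !) * (+ 3 * + (m ℕ.* m) * (W * W))))
          ≡⟨ cong (λ c → E * (T * c)) (trans (sym (*-assoc (+ (m !) * + (m !)) (+ 3 * + (m ℕ.* m)) (W * W)))
               (cong₂ _*_ (sym (pos-*₄ (m !) (m !) 3 (m ℕ.* m)))
                 (trans (cong₂ _*_ W≡ W≡) (sym (pos-* w w))))) ⟩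
        E * (T * (+ c * + (w ℕ.* w)))
          ≡⟨ regroup E T (+ c) (+ (w ℕ.* w)) ⟩
        T * (E * + c * + (w ℕ.* w))
          ≤⟨ *-monoˡ-≤-nonNeg T (subst (λ z → z * + (w ℕ.* w) ≤ z * + (K ℕ.* D ℕ.* (K ℕ.* D)))
               (pos-* (suc e ℕ.* suc e) c)
               (*-monoˡ-≤-nonNeg (+ (suc e ℕ.* suc e ℕ.* c)) (+≤+ (ℕ.*-mono-≤ w≤ w≤)))) ⟩
        T * (E * + c * + (K ℕ.* D ℕ.* (K ℕ.* D)))
          ≡⟨ cong₂ (λ x y → T * (x * y)) (sym (pos-* (suc e ℕ.* suc e) c))
               (trans (cong +_ (ℕ.[m*n]*[o*p]≡[m*o]*[n*p] K D K D)) (pos-* (K ℕ.* K) (D ℕ.* D))) ⟩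
        T * (+ (suc e ℕ.* suc e ℕ.* c) * (+ (K ℕ.* K) * + (D ℕ.* D)))
          ≡⟨ reassociate T (+ (suc e ℕ.* suc e ℕ.* c)) (+ (K ℕ.* K)) (+ (D ℕ.* D)) ⟩
        T * (+ (suc e ℕ.* suc e ℕ.* c) * + (K ℕ.* K)) * + (D ℕ.* D)
          ≡⟨ cong (λ z → T * z * + (D ℕ.* D)) (pos-* (suc e ℕ.* suc e ℕ.* c) (K ℕ.* K)) ⟨
        T * + (chebyshev-factor e) * + (D ℕ.* D)
          ≡⟨ trans (pos-* (length LS ℕ.* chebyshev-factor e) (D ℕ.* D))
                   (cong (_* + (D ℕ.* D)) (pos-* (length LS) (chebyshev-factor e))) ⟨
        + (length LS ℕ.* chebyshev-factor e ℕ.* (D ℕ.* D)) ∎))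
        where
        open ≤-Reasoning
        E = + (suc e ℕ.* suc e)
        T = + length LS
        W = all-placements n k ℓ
        w = n ^ k ℕ.* n ^ ℓ
        c = m ! ℕ.* m ! ℕ.* (3 ℕ.* (m ℕ.* m))
        W≡ : W ≡ + w
        W≡ = sym (pos-* (n ^ k) (n ^ ℓ))
        w≤ : w ℕ.≤ K ℕ.* D
        w≤ = drop‿+≤+ (subst₂ _≤_ W≡ (sym (pos-* K D)) (all-placements≤ n 2k≤n 2ℓ≤n))
        pos-*₄ : ∀ a b c d → + (a ℕ.* b ℕ.* (c ℕ.* d)) ≡ + a * + b * (+ c * + d)
        pos-*₄ a b c d = trans (pos-* (a ℕ.* b) (c ℕ.* d)) (cong₂ _*_ (pos-* a b) (pos-* c d))
        swap-factors : ∀ a b c → a * (b * c) ≡ b * (a * c)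
        swap-factors = solve-∀
        regroup : ∀ e t c w → e * (t * (c * w)) ≡ t * (e * c * w)
        regroup = solve-∀
        reassociate : ∀ t z k d → t * (z * (k * d)) ≡ t * (z * k) * d
        reassociate = solve-∀

      close+far : length (filter close? LS) ℕ.+ far-count ≡ length LS
      close+far = +-injective (begin
        + (length (filter close? LS) ℕ.+ far-count)
          ≡⟨ pos-+ (length (filter close? LS)) far-count ⟩
        + length (filter close? LS) + + far-count
          ≡⟨ cong₂ _+_ (length-filter≡∑ close? LS) (length-filter≡∑ (λ L → ¬? (close? L)) LS) ⟩
        (∑[ L ∈ LS ] χ (close? L)) + (∑[ L ∈ LS ] χ (¬? (close? L)))
          ≡⟨ ∑-+ LS _ _ ⟨
        (∑[ L ∈ LS ] (χ (close? L) + χ (¬? (close? L))))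
          ≡⟨ ∑-cong LS (λ L → χ-¬ (close? L)) ⟩
        (∑[ L ∈ LS ] 1ℤ)
          ≡⟨ length≡∑ LS ⟨
        + length LS ∎)
        where open ≡-Reasoning

      proportion-close : ∀ d → suc d ℕ.* suc (chebyshev-factor e) ℕ.≤ n →
                         ℚ.∣ proportion ε A n ℚ.- 1ℚ ∣ ℚ.≤ + 1 / suc d
      proportion-close d n-large = go (length LS) refl
        where
        far-few : suc d ℕ.* far-count ℕ.≤ length LS
        far-few = ℕ.*-cancelʳ-≤ _ _ (suc Z) (begin
          suc d ℕ.* far-count ℕ.* suc Z    ≡⟨ ℕ*.xy∙z≈xz∙y (suc d) far-count (suc Z) ⟩
          suc d ℕ.* suc Z ℕ.* far-count    ≤⟨ ℕ.*-monoˡ-≤ far-count n-large ⟩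
          n ℕ.* far-count                  ≤⟨ far-count-bound ⟩
          length LS ℕ.* Z                  ≤⟨ ℕ.*-monoʳ-≤ (length LS) (ℕ.n≤1+n Z) ⟩
          length LS ℕ.* suc Z              ∎)
          where
          open ℕ.≤-Reasoning
          Z = chebyshev-factor e
        nonempty : 0 ℕ.< length LS
        nonempty = subst (λ n → 0 ℕ.< length (latinSquares n)) (ℕ.suc-pred n {{ℕ.>-nonZero 0<n}})
                     (latinSquares-nonempty (ℕ.pred n))
        -- The number of squares is matched so that `÷` computes; the case `zero`, where the
        -- quotient would default to 0, is excluded by `nonempty`.
        go : ∀ T → length LS ≡ T → ℚ.∣ (length (filter close? LS) ÷ T) ℚ.- 1ℚ ∣ ℚ.≤ + 1 / suc d
        go zero    empty = contradiction nonempty (ℕ.<-irrefl (sym empty))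
        -- Here 1 is taken as the reciprocal of `suc 0`, and the numerator of the difference is the
        -- negative of the number of far squares.
        go (suc T) size  = ratio-close (length (filter close? LS)) T 0 d (begin
          suc d ℕ.* ∣ + 1 * + length (filter close? LS) - + suc T ∣
            ≡⟨ cong (suc d ℕ.*_) (trans (cong ∣_∣ difference) (∣-i∣≡∣i∣ (+ far-count))) ⟩
          suc d ℕ.* far-count
            ≤⟨ far-few ⟩
          length LS
            ≡⟨ trans size (sym (ℕ.*-identityˡ (suc T))) ⟩
          1 ℕ.* suc T ∎)
          where
          open ℕ.≤-Reasoning
          cancel : ∀ a b → 1ℤ * a - (a + b) ≡ - b
          cancel = solve-∀
          difference : + 1 * + length (filter close? LS) - + suc T ≡ - (+ far-count)
          difference = trans (cong (λ t → + 1 * + length (filter close? LS) - t)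
            (trans (cong +_ (trans (sym size) (sym close+far))) (pos-+ (length (filter close? LS)) far-count)))
            (cancel (+ length (filter close? LS)) (+ far-count))

    eventually-close : {A : Matrix (Fin m) k ℓ} → InR k ℓ A → (ε : ℚ) (e : ℕ) → + 1 / suc e ℚ.≤ ε →
      (d n : ℕ) → threshold e d ℕ.≤ n → ℚ.∣ proportion ε A n ℚ.- 1ℚ ∣ ℚ.≤ + 1 / suc d
    eventually-close A∈R ε e 1/e≤ε d n large =
      proportion-close A∈R ε e 1/e≤ε n (ℕ.≤-trans (ℕ.s≤s ℕ.z≤n) N≤n)
        (ℕ.≤-trans (ℕ.m≤m+n (2 ℕ.* k) (2 ℕ.* ℓ)) 2k+2ℓ≤n) (ℕ.≤-trans (ℕ.m≤n+m (2 ℕ.* ℓ) (2 ℕ.* k)) 2k+2ℓ≤n)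
        d N≤n
      where
      N = suc d ℕ.* suc (chebyshev-factor e)
      N≤n : N ℕ.≤ n
      N≤n = ℕ.≤-trans (ℕ.m≤m+n N (2 ℕ.* k ℕ.+ 2 ℕ.* ℓ)) large
      2k+2ℓ≤n : 2 ℕ.* k ℕ.+ 2 ℕ.* ℓ ℕ.≤ n
      2k+2ℓ≤n = ℕ.≤-trans (ℕ.m≤n+m (2 ℕ.* k ℕ.+ 2 ℕ.* ℓ) N) large

open import Data.Nat as ℕ using (ℕ; _*_)
open import Data.Fin using (Fin)
open import Data.Product using (∃-syntax; _,_)
open import Data.Rational as ℚ using (ℚ; 0ℚ; 1ℚ; ∣_∣; _-_)
open import Data.Rational.Properties using (≤-trans)
open Ratios using (reciprocal-below)
open Main using (threshold; eventually-close)

theorem12p3 : (ε : ℚ) → 0ℚ ℚ.< ε → (k ℓ : ℕ) → (A : Matrix (Fin (k * ℓ)) k ℓ) → InR k ℓ A →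
    (δ : ℚ) → 0ℚ ℚ.< δ → ∃[ N ] ((n : ℕ) → N ℕ.≤ n → ∣ proportion ε A n - 1ℚ ∣ ℚ.≤ δ)
theorem12p3 ε ε>0 k ℓ A A∈R δ δ>0 =
  let e , 1/e≤ε = reciprocal-below ε ε>0
      d , 1/d≤δ = reciprocal-below δ δ>0
  in threshold k ℓ e d , λ n N≤n → ≤-trans (eventually-close k ℓ A∈R ε e 1/e≤ε d n N≤n) 1/d≤δ
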